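{- Let $G=(V,E)$ be a finite simple graph. If the minimum degree of $G$ satisfies $$\delta(G) \geq \frac{2|V|}{3} - 1,$$ then $Ric(G) \geq 0$, i.e. the Lin-Lu-Yau curvature satisfies $\kappa(x,y) \geq 0$ for every edge $x \sim y$ of $G$.
   Context: Graphs are simple: unweighted, undirected, without multiple edges or self-loops, with nonempty vertex set. Write $x\sim y$ if $x,y\in V$ are joined by an edge. The combinatorial graph distance is $d(x,y)=\inf\{n : x=x_0\sim x_1\sim\dots\sim x_n=y\}$ (with $\inf\emptyset=\infty$). The degree $d_x$ of a vertex $x$ is its number of neighbors, and $\delta(G)=\min_{x\in V} d_x$. For probability measures $\mu_1,\mu_2$ on $V$, the Wasserstein distance is $$W_1(\mu_1,\mu_2)=\inf_{\pi\in\Pi(\mu_1,\mu_2)}\sum_{x\in V}\sum_{y\in V} d(x,y)\,\pi(x,y),$$ where $\Pi(\mu_1,\mu_2)$ is the set of $\pi:V\times V\to[0,1]$ with $\sum_{y\in V}\pi(x,y)=\mu_1(x)$ for all $x$ and $\sum_{x\in V}\pi(x,y)=\mu_2(y)$ for all $y$ (with the convention $\infty\cdot 0=0$). For $\alpha\in[0,1]$ and a vertex $x$ with $d_x\ge 1$, let $\mu_x^\alpha$ be the probability measure on $V$ given by $\mu_x^\alpha(x)=\alpha$, $\mu_x^\alpha(y)=\frac{1-\alpha}{d_x}$ if $y\sim x$, and $\mu_x^\alpha(y)=0$ otherwise. For an edge $x\sim y$, the $\alpha$-Ollivier-Ricci curvature is $\kappa_\alpha(x,y)=1-W_1(\mu_x^\alpha,\mu_y^\alpha)$,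 and the Lin-Lu-Yau curvature is $$\kappa(x,y)=\lim_{\alpha\to 1}\frac{\kappa_\alpha(x,y)}{1-\alpha}$$ (limit as $\alpha\uparrow 1$, $\alpha<1$; this limit is known to exist). For a real number $k$, $Ric(G)\ge k$ means $\kappa(x,y)\ge k$ for all edges $x\sim y$ of $G$. -}

module Defs where

open import Data.Nat.Base as ℕ using (ℕ; zero; suc; z≤n; s≤s)
import Data.Nat.Properties as ℕₚ
open import Data.Nat.Induction using (<-rec)
open import Data.Integer.Base using (+_)
open import Data.Rational.Base as ℚ using (ℚ; 0ℚ; 1ℚ; ½; ∣_∣; 1/_)
import Data.Rational.Properties as ℚₚ
open import Data.Rational.Solver using (module +-*-Solver)
open import Data.Fin.Base as Fin using (Fin; toℕ)
import Data.Fin.Properties as Finₚ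
open import Data.List.Base using (length; filter; map; allFin)
open import Data.List.Extrema.Nat using (min)
open import Data.List.Membership.Propositional using (_∈_)
open import Data.List.Membership.Propositional.Properties using (∈-filter⁺; ∈-allFin)
open import Data.List.Relation.Unary.Any using (here; there)
open import Data.Product.Base using (_×_; _,_; ∃; proj₂)
open import Function.Base using (_∘_; case_of_)
open import Relation.Binary.Core using (Rel)
import Relation.Binary.Definitions as B
open import Relation.Binary.PropositionalEquality
open import Relation.Nullary using (¬_; yes; no; contradiction)
open import Relation.Nullary.Decidable using (_×-dec_)
open import Relation.Nullary.Construct.Add.Supremum using (_⁺; [_]; ⊤⁺)
open import Relation.Unary using (Pred; Decidable)
open import Level using (0ℓ)

-- Real numbers: Cauchy sequences of rationals, as a setoid under _≈_

IsCauchy : (ℕ → ℚ) → Set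
IsCauchy x = ∀ ε → 0ℚ ℚ.< ε →
  ∃ λ N → ∀ m n → N ℕ.≤ m → N ℕ.≤ n → ∣ x m ℚ.- x n ∣ ℚ.< ε

-- Without η, and with the operations defined by copatterns, x + y etc. unfold
-- only under seq, so that unification treats them as rigid.
record ℝ : Set where
  no-eta-equality
  field
    seq    : ℕ → ℚ
    cauchy : IsCauchy seq

open ℝ public

infix  4 _≈_ _≤_ _<_
infixl 6 _+_ _-_
infixl 7 _*_
infix  8 -_

record _≈_ (x y : ℝ) : Set where
  constructor mk≈
  field
    eventually-close : ∀ ε → 0ℚ ℚ.< ε →
      ∃ λ N → ∀ n → N ℕ.≤ n → ∣ seq x n ℚ.- seq y n ∣ ℚ.< ε

record _≤_ (x y : ℝ) : Set where
  constructor mk≤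
  field
    eventually-≤ : ∀ ε → 0ℚ ℚ.< ε →
      ∃ λ N → ∀ n → N ℕ.≤ n → seq x n ℚ.≤ seq y n ℚ.+ ε

record _<_ (x y : ℝ) : Set where
  constructor mk<
  field
    gap   : ℚ
    gap>0 : 0ℚ ℚ.< gap
    from  : ℕ
    apart : ∀ n → from ℕ.≤ n → seq x n ℚ.+ gap ℚ.≤ seq y n

fromℚ : ℚ → ℝ
seq    (fromℚ q) _     = q
cauchy (fromℚ q) ε 0<ε = 0 , λ _ _ _ _ →
  subst (ℚ._< ε) (sym (cong ∣_∣ (ℚₚ.+-inverseʳ q))) 0<ε

0ℝ 1ℝ : ℝ
0ℝ = fromℚ 0ℚ
1ℝ = fromℚ 1ℚ

private
  open +-*-Solver

  0<½*_ : ∀ {ε} → 0ℚ ℚ.< ε → 0ℚ ℚ.< ½ ℚ.* ε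
  0<½* 0<ε = ℚₚ.*-monoʳ-<-pos ½ 0<ε

  halves : ∀ ε → ½ ℚ.* ε ℚ.+ ½ ℚ.* ε ≡ ε
  halves = solve 1 (λ e → con ½ :* e :+ con ½ :* e := e) refl

  *-pos : ∀ {p q} → 0ℚ ℚ.< p → 0ℚ ℚ.< q → 0ℚ ℚ.< p ℚ.* q
  *-pos {p} {q} 0<p 0<q = subst (ℚ._< p ℚ.* q) (ℚₚ.*-zeroʳ p)
    (ℚₚ.*-monoʳ-<-pos p {{ℚ.positive 0<p}} 0<q)

  *-monoˡ : ∀ {r p q} → 0ℚ ℚ.≤ r → p ℚ.≤ q → p ℚ.* r ℚ.≤ q ℚ.* r
  *-monoˡ {r} 0≤r p≤q = ℚₚ.*-monoʳ-≤-nonNeg r {{ℚ.nonNegative 0≤r}} p≤q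

  *-monoʳ-< : ∀ {r p q} → 0ℚ ℚ.< r → p ℚ.< q → r ℚ.* p ℚ.< r ℚ.* q
  *-monoʳ-< {r} 0<r p<q = ℚₚ.*-monoʳ-<-pos r {{ℚ.positive 0<r}} p<q

  ∃-half : ∀ {B ε} → 0ℚ ℚ.< B → 0ℚ ℚ.< ε →
           ∃ λ δ → 0ℚ ℚ.< δ × B ℚ.* δ ≡ ½ ℚ.* ε
  ∃-half {B} {ε} 0<B 0<ε = B⁻¹ ℚ.* (½ ℚ.* ε) ,
    *-pos (ℚₚ.positive⁻¹ B⁻¹ {{ℚₚ.1/pos⇒pos B}}) (0<½* 0<ε) ,
    trans (sym (ℚₚ.*-assoc B B⁻¹ _))
      (trans (cong (ℚ._* (½ ℚ.* ε)) (ℚₚ.*-inverseʳ B)) (ℚₚ.*-identityˡ _))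
    where
    instance
      B>0 : ℚ.Positive B
      B>0 = ℚ.positive 0<B
      B≢0 : ℚ.NonZero B
      B≢0 = ℚₚ.pos⇒nonZero B
    B⁻¹ = 1/ B

  bounded : ∀ x → ∃ λ B → 0ℚ ℚ.< B × (∃ λ N → ∀ n → N ℕ.≤ n → ∣ seq x n ∣ ℚ.≤ B)
  bounded x with cauchy x 1ℚ (ℚₚ.positive⁻¹ 1ℚ)
  ... | N , close = 1ℚ ℚ.+ ∣ seq x N ∣ ,
    ℚₚ.+-mono-<-≤ {0ℚ} {1ℚ} {0ℚ} {∣ seq x N ∣} (ℚₚ.positive⁻¹ 1ℚ) (ℚₚ.0≤∣p∣ (seq x N)) , N , λ n N≤n → begin
      ∣ seq x n ∣                            ≡⟨ cong ∣_∣ (split (seq x n) (seq x N)) ⟩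
      ∣ (seq x n ℚ.- seq x N) ℚ.+ seq x N ∣  ≤⟨ ℚₚ.∣p+q∣≤∣p∣+∣q∣ (seq x n ℚ.- seq x N) (seq x N) ⟩
      ∣ seq x n ℚ.- seq x N ∣ ℚ.+ ∣ seq x N ∣
        ≤⟨ ℚₚ.+-monoˡ-≤ ∣ seq x N ∣ (ℚₚ.<⇒≤ (close n N N≤n ℕₚ.≤-refl)) ⟩
      1ℚ ℚ.+ ∣ seq x N ∣                     ∎
    where
    open ℚₚ.≤-Reasoning
    split : ∀ a b → a ≡ (a ℚ.- b) ℚ.+ b
    split = solve 2 (λ a b → a := (a :- b) :+ b) refl

_+_ : ℝ → ℝ → ℝ
seq    (x + y) n     = seq x n ℚ.+ seq y n
cauchy (x + y) ε 0<ε =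
  let M , closeˣ = cauchy x (½ ℚ.* ε) (0<½* 0<ε)
      N , closeʸ = cauchy y (½ ℚ.* ε) (0<½* 0<ε)
  in M ℕ.⊔ N , λ m n ≤m ≤n → begin-strict
    ∣ (seq x m ℚ.+ seq y m) ℚ.- (seq x n ℚ.+ seq y n) ∣
      ≡⟨ cong ∣_∣ (rearrange (seq x m) (seq y m) (seq x n) (seq y n)) ⟩
    ∣ (seq x m ℚ.- seq x n) ℚ.+ (seq y m ℚ.- seq y n) ∣
      ≤⟨ ℚₚ.∣p+q∣≤∣p∣+∣q∣ (seq x m ℚ.- seq x n) _ ⟩
    ∣ seq x m ℚ.- seq x n ∣ ℚ.+ ∣ seq y m ℚ.- seq y n ∣
      <⟨ ℚₚ.+-mono-< (closeˣ m n (ℕₚ.m⊔n≤o⇒m≤o M N ≤m) (ℕₚ.m⊔n≤o⇒m≤o M N ≤n))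
                     (closeʸ m n (ℕₚ.m⊔n≤o⇒n≤o M N ≤m) (ℕₚ.m⊔n≤o⇒n≤o M N ≤n)) ⟩
    ½ ℚ.* ε ℚ.+ ½ ℚ.* ε  ≡⟨ halves ε ⟩
    ε                    ∎
  where
  open ℚₚ.≤-Reasoning
  rearrange : ∀ a b c d → (a ℚ.+ b) ℚ.- (c ℚ.+ d) ≡ (a ℚ.- c) ℚ.+ (b ℚ.- d)
  rearrange = solve 4 (λ a b c d → (a :+ b) :- (c :+ d) := (a :- c) :+ (b :- d)) refl

-_ : ℝ → ℝ
seq    (- x) n     = ℚ.- seq x n
cauchy (- x) ε 0<ε =
  let N , close = cauchy x ε 0<ε
  in N , λ m n ≤m ≤n → subst (ℚ._< ε)
    (trans (sym (ℚₚ.∣-p∣≡∣p∣ (seq x m ℚ.- seq x n)))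
           (cong ∣_∣ (ℚₚ.neg-distrib-+ (seq x m) (ℚ.- seq x n))))
    (close m n ≤m ≤n)

_-_ : ℝ → ℝ → ℝ
x - y = x + (- y)

_*_ : ℝ → ℝ → ℝ
seq    (x * y) n     = seq x n ℚ.* seq y n
cauchy (x * y) ε 0<ε =
  let A , 0<A , K , x≤A = bounded x
      B , 0<B , L , y≤B = bounded y
      δ , 0<δ , Aδ      = ∃-half 0<A 0<ε
      η , 0<η , Bη      = ∃-half 0<B 0<ε
      M , closeˣ        = cauchy x η 0<η
      N , closeʸ        = cauchy y δ 0<δ
      KL = K ℕ.⊔ L
      MN = M ℕ.⊔ N
  in KL ℕ.⊔ MN , λ m n ≤m ≤n →
    let KL≤m = ℕₚ.m⊔n≤o⇒m≤o KL MN ≤m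
        KL≤n = ℕₚ.m⊔n≤o⇒m≤o KL MN ≤n
        MN≤m = ℕₚ.m⊔n≤o⇒n≤o KL MN ≤m
        MN≤n = ℕₚ.m⊔n≤o⇒n≤o KL MN ≤n
        dx = seq x m ℚ.- seq x n
        dy = seq y m ℚ.- seq y n
    in begin-strict
    ∣ seq x m ℚ.* seq y m ℚ.- seq x n ℚ.* seq y n ∣
      ≡⟨ cong ∣_∣ (rearrange (seq x m) (seq y m) (seq x n) (seq y n)) ⟩
    ∣ seq x m ℚ.* dy ℚ.+ seq y n ℚ.* dx ∣
      ≤⟨ ℚₚ.∣p+q∣≤∣p∣+∣q∣ (seq x m ℚ.* dy) _ ⟩
    ∣ seq x m ℚ.* dy ∣ ℚ.+ ∣ seq y n ℚ.* dx ∣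
      ≡⟨ cong₂ ℚ._+_ (ℚₚ.∣p*q∣≡∣p∣*∣q∣ (seq x m) dy) (ℚₚ.∣p*q∣≡∣p∣*∣q∣ (seq y n) dx) ⟩
    ∣ seq x m ∣ ℚ.* ∣ dy ∣ ℚ.+ ∣ seq y n ∣ ℚ.* ∣ dx ∣
      ≤⟨ ℚₚ.+-mono-≤ (*-monoˡ (ℚₚ.0≤∣p∣ dy) (x≤A m (ℕₚ.m⊔n≤o⇒m≤o K L KL≤m)))
                     (*-monoˡ (ℚₚ.0≤∣p∣ dx) (y≤B n (ℕₚ.m⊔n≤o⇒n≤o K L KL≤n))) ⟩
    A ℚ.* ∣ dy ∣ ℚ.+ B ℚ.* ∣ dx ∣
      <⟨ ℚₚ.+-mono-<
           (*-monoʳ-< 0<A (closeʸ m n (ℕₚ.m⊔n≤o⇒n≤o M N MN≤m) (ℕₚ.m⊔n≤o⇒n≤o M N MN≤n)))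
           (*-monoʳ-< 0<B (closeˣ m n (ℕₚ.m⊔n≤o⇒m≤o M N MN≤m) (ℕₚ.m⊔n≤o⇒m≤o M N MN≤n))) ⟩
    A ℚ.* δ ℚ.+ B ℚ.* η  ≡⟨ cong₂ ℚ._+_ Aδ Bη ⟩
    ½ ℚ.* ε ℚ.+ ½ ℚ.* ε  ≡⟨ halves ε ⟩
    ε                    ∎
  where
  open ℚₚ.≤-Reasoning
  rearrange : ∀ a b c d → a ℚ.* b ℚ.- c ℚ.* d ≡ a ℚ.* (b ℚ.- d) ℚ.+ d ℚ.* (a ℚ.- c)
  rearrange = solve 4 (λ a b c d → a :* b :- c :* d := a :* (b :- d) :+ d :* (a :- c)) refl

-- 1/q, totalised by 0 at q = 0: only finitely many terms of a positive real
-- can hit that case.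
recipℚ : ℚ → ℚ
recipℚ q with q ℚₚ.≟ 0ℚ
... | yes _   = 0ℚ
... | no  q≢0 = (1/ q) {{ℚ.≢-nonZero q≢0}}

recipℚ-pos : ∀ {q} → 0ℚ ℚ.< q → 0ℚ ℚ.< recipℚ q × q ℚ.* recipℚ q ≡ 1ℚ
recipℚ-pos {q} 0<q with q ℚₚ.≟ 0ℚ
... | yes q≡0 = contradiction (sym q≡0) (ℚₚ.<⇒≢ 0<q)
... | no  q≢0 =
  ℚₚ.positive⁻¹ _ {{ℚₚ.1/pos⇒pos q {{ℚ.positive 0<q}}}} ,
  ℚₚ.*-inverseʳ q {{ℚ.≢-nonZero q≢0}}

recip : (x : ℝ) → 0ℝ < x → ℝ
seq    (recip x _)                 n     = recipℚ (seq x n)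
cauchy (recip x (mk< c 0<c K c≤x)) ε 0<ε =
  let εcc = ε ℚ.* (c ℚ.* c)
      N , close = cauchy x εcc (*-pos 0<ε (*-pos 0<c 0<c))
  in K ℕ.⊔ N , λ m n ≤m ≤n →
    let a = seq x m ; ra = recipℚ a
        b = seq x n ; rb = recipℚ b
        c≤a = below m (ℕₚ.m⊔n≤o⇒m≤o K N ≤m)
        c≤b = below n (ℕₚ.m⊔n≤o⇒m≤o K N ≤n)
        0<ra , a*ra = recipℚ-pos (ℚₚ.<-≤-trans 0<c c≤a)
        0<rb , b*rb = recipℚ-pos (ℚₚ.<-≤-trans 0<c c≤b)
        0<rr = *-pos 0<rb 0<ra
        c*ra≤1 = ℚₚ.≤-trans (*-monoˡ (ℚₚ.<⇒≤ 0<ra) c≤a) (ℚₚ.≤-reflexive a*ra)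
        c*rb≤1 = ℚₚ.≤-trans (*-monoˡ (ℚₚ.<⇒≤ 0<rb) c≤b) (ℚₚ.≤-reflexive b*rb)
    in begin-strict
    ∣ ra ℚ.- rb ∣
      ≡⟨ cong ∣_∣ (sym (cong₂ ℚ._-_ (trans (cong (ra ℚ.*_) b*rb) (ℚₚ.*-identityʳ ra))
                                    (trans (cong (rb ℚ.*_) a*ra) (ℚₚ.*-identityʳ rb)))) ⟩
    ∣ ra ℚ.* (b ℚ.* rb) ℚ.- rb ℚ.* (a ℚ.* ra) ∣
      ≡⟨ cong ∣_∣ (factor a b ra rb) ⟩
    ∣ (rb ℚ.* ra) ℚ.* (b ℚ.- a) ∣
      ≡⟨ ℚₚ.∣p*q∣≡∣p∣*∣q∣ (rb ℚ.* ra) (b ℚ.- a) ⟩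
    ∣ rb ℚ.* ra ∣ ℚ.* ∣ b ℚ.- a ∣
      ≡⟨ cong (ℚ._* ∣ b ℚ.- a ∣) (ℚₚ.0≤p⇒∣p∣≡p (ℚₚ.<⇒≤ 0<rr)) ⟩
    (rb ℚ.* ra) ℚ.* ∣ b ℚ.- a ∣
      <⟨ *-monoʳ-< 0<rr (close n m (ℕₚ.m⊔n≤o⇒n≤o K N ≤n) (ℕₚ.m⊔n≤o⇒n≤o K N ≤m)) ⟩
    (rb ℚ.* ra) ℚ.* (ε ℚ.* (c ℚ.* c))
      ≡⟨ regroup c ra rb ε ⟩
    (c ℚ.* ra) ℚ.* ((c ℚ.* rb) ℚ.* ε)
      ≤⟨ *-monoˡ (ℚₚ.<⇒≤ (*-pos (*-pos 0<c 0<rb) 0<ε)) c*ra≤1 ⟩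
    1ℚ ℚ.* ((c ℚ.* rb) ℚ.* ε)
      ≡⟨ ℚₚ.*-identityˡ _ ⟩
    (c ℚ.* rb) ℚ.* ε
      ≤⟨ *-monoˡ (ℚₚ.<⇒≤ 0<ε) c*rb≤1 ⟩
    1ℚ ℚ.* ε  ≡⟨ ℚₚ.*-identityˡ ε ⟩
    ε         ∎
  where
  open ℚₚ.≤-Reasoning
  below : ∀ n → K ℕ.≤ n → c ℚ.≤ seq x n
  below n K≤n = subst (ℚ._≤ seq x n) (ℚₚ.+-identityˡ c) (c≤x n K≤n)
  factor : ∀ a b r s → r ℚ.* (b ℚ.* s) ℚ.- s ℚ.* (a ℚ.* r) ≡ (s ℚ.* r) ℚ.* (b ℚ.- a)
  factor = solve 4 (λ a b r s → r :* (b :* s) :- s :* (a :* r) := (s :* r) :* (b :- a)) refl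
  regroup : ∀ c r s e → (s ℚ.* r) ℚ.* (e ℚ.* (c ℚ.* c)) ≡ (c ℚ.* r) ℚ.* ((c ℚ.* s) ℚ.* e)
  regroup = solve 4 (λ c r s e → (s :* r) :* (e :* (c :* c)) := (c :* r) :* ((c :* s) :* e)) refl

*-recip : ∀ x (0<x : 0ℝ < x) → x * recip x 0<x ≈ 1ℝ
*-recip x (mk< c 0<c K c≤x) = mk≈ λ ε 0<ε → K , λ n K≤n →
  let 0<xₙ = ℚₚ.<-≤-trans 0<c (subst (ℚ._≤ seq x n) (ℚₚ.+-identityˡ c) (c≤x n K≤n))
  in subst (ℚ._< ε) (cong (λ q → ∣ q ℚ.- 1ℚ ∣) (sym (proj₂ (recipℚ-pos 0<xₙ)))) 0<ε

x<y⇒0<y-x : ∀ {x y} → x < y → 0ℝ < y - x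
x<y⇒0<y-x {x} {y} (mk< c 0<c K x+c≤y) = mk< c 0<c K λ n K≤n → begin
  0ℚ ℚ.+ c                         ≡⟨ rearrange (seq x n) c ⟩
  (seq x n ℚ.+ c) ℚ.+ ℚ.- seq x n  ≤⟨ ℚₚ.+-monoˡ-≤ (ℚ.- seq x n) (x+c≤y n K≤n) ⟩
  seq y n ℚ.+ ℚ.- seq x n          ∎
  where
  open ℚₚ.≤-Reasoning
  rearrange : ∀ a c → 0ℚ ℚ.+ c ≡ (a ℚ.+ c) ℚ.+ ℚ.- a
  rearrange = solve 2 (λ a c → con 0ℚ :+ c := (a :+ c) :+ (:- a)) refl

∑ : ∀ {n} → (Fin n → ℝ) → ℝ
∑ {zero}  f = 0ℝ
∑ {suc n} f = f Fin.zero + ∑ (f ∘ Fin.suc)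

IsInfimum : Pred ℝ 0ℓ → ℝ → Set
IsInfimum S w = (∀ c → S c → w ≤ c) × (∀ l → (∀ c → S c → l ≤ c) → l ≤ w)

record Graph (n : ℕ) : Set₁ where
  infix 4 _~_ _~?_
  field
    _~_    : Rel (Fin n) 0ℓ
    _~?_   : B.Decidable _~_
    ~-sym  : B.Symmetric _~_
    ~-irrefl : ∀ {x} → ¬ (x ~ x)

module _ {n : ℕ} (G : Graph n) where
  open Graph G

  degree : Fin n → ℕ
  degree x = length (filter (x ~?_) (allFin n))

  ~⇒degree≢0 : ∀ {x y} → x ~ y → ℕ.NonZero (degree x)
  ~⇒degree≢0 {x} {y} x~y = inhabited (∈-filter⁺ (x ~?_) (∈-allFin y) x~y)
    where
    inhabited : ∀ {z : Fin n} {zs} → z ∈ zs → ℕ.NonZero (length zs)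
    inhabited (here _)  = _
    inhabited (there _) = _

  data Walk : ℕ → Rel (Fin n) 0ℓ where
    []  : ∀ {x} → Walk 0 x x
    _∷_ : ∀ {k x y z} → x ~ y → Walk k y z → Walk (suc k) x z

  walk? : ∀ k → B.Decidable (Walk k)
  walk? zero x y with x Finₚ.≟ y
  ... | yes refl = yes []
  ... | no  x≢y  = no λ { [] → x≢y refl }
  walk? (suc k) x y with Finₚ.any? (λ z → (x ~? z) ×-dec walk? k z y)
  ... | yes (_ , x~z , w) = yes (x~z ∷ w)
  ... | no  ¬w            = no λ { (x~z ∷ w) → ¬w (_ , x~z , w) }

minDegree : ∀ {n} .{{_ : ℕ.NonZero n}} → Graph n → ℕ
minDegree {suc n} G = min (degree G Fin.zero) (map (degree G) (allFin (suc n)))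

sucᵀ : ℕ ⁺ → ℕ ⁺
sucᵀ ⊤⁺    = ⊤⁺
sucᵀ [ k ] = [ suc k ]

leastBelow : ℕ → {P : Pred ℕ 0ℓ} → Decidable P → ℕ ⁺
leastBelow zero    P? = ⊤⁺
leastBelow (suc b) P? with P? 0
... | yes _ = [ 0 ]
... | no  _ = sucᵀ (leastBelow b (P? ∘ suc))

module _ {n : ℕ} (G : Graph n) where
  open Graph G

  -- ⊤⁺ is ∞.  Searching lengths below |V| suffices, see dist-correct.
  dist : Fin n → Fin n → ℕ ⁺
  dist x y = leastBelow n (λ k → walk? G k x y)

  IsDistance : Fin n → Fin n → ℕ ⁺ → Set
  IsDistance x y [ m ] = Walk G m x y × (∀ k → Walk G k x y → m ℕ.≤ k)
  IsDistance x y ⊤⁺    = ∀ k → ¬ Walk G k x y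

  private
    IsLeastBelow : ℕ → Pred ℕ 0ℓ → ℕ ⁺ → Set
    IsLeastBelow b P [ m ] = P m × (∀ k → P k → m ℕ.≤ k)
    IsLeastBelow b P ⊤⁺    = ∀ k → k ℕ.< b → ¬ P k

    leastBelow-correct : ∀ b {P : Pred ℕ 0ℓ} (P? : Decidable P) →
                         IsLeastBelow b P (leastBelow b P?)
    leastBelow-correct zero    P? = λ _ ()
    leastBelow-correct (suc b) P? with P? 0
    ... | yes p0 = p0 , λ _ _ → z≤n
    ... | no ¬p0 with leastBelow b (P? ∘ suc) | leastBelow-correct b (P? ∘ suc)
    ...   | ⊤⁺    | none = λ { zero _ p0 → ¬p0 p0 ; (suc k) (s≤s k<b) → none k k<b }
    ...   | [ m ] | pm , least = pm , λ { zero p0 → contradiction p0 ¬p0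
                                        ; (suc k) pk → s≤s (least k pk) }

    vertex : ∀ {k x y} → Walk G k x y → Fin (suc k) → Fin n
    vertex {x = x} w       Fin.zero    = x
    vertex         (e ∷ w) (Fin.suc i) = vertex w i

    drop : ∀ {k x y} (w : Walk G k x y) i → Walk G (k ℕ.∸ toℕ i) (vertex w i) y
    drop w       Fin.zero    = w
    drop (e ∷ w) (Fin.suc i) = drop w i

    cut : ∀ {k x y} (w : Walk G k x y) i j → i Fin.< j → vertex w i ≡ vertex w j →
          ∃ λ l → l ℕ.< k × Walk G l x y
    cut {k} w@(_ ∷ _) Fin.zero (Fin.suc j) _ eq =
      _ , s≤s (ℕₚ.m∸n≤m _ (toℕ j)) , subst (λ v → Walk G _ v _) (sym eq) (drop w (Fin.suc j))
    cut (e ∷ w) (Fin.suc i) (Fin.suc j) (s≤s i<j) eq with cut w i j i<j eq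
    ... | l , l<k , w′ = suc l , s≤s l<k , e ∷ w′

    shorten : ∀ {x y} k → Walk G k x y → ∃ λ l → l ℕ.< n × Walk G l x y
    shorten {x} {y} = <-rec _ λ k rec w → case k ℕₚ.<? n of λ where
      (yes k<n) → k , k<n , w
      (no  k≮n) →
        let i , j , i<j , eq = Finₚ.pigeonhole (s≤s (ℕₚ.≮⇒≥ k≮n)) (vertex w)
            l , l<k , w′     = cut w i j i<j eq
        in rec l<k w′

  dist-correct : ∀ x y → IsDistance x y (dist x y)
  dist-correct x y with dist x y | leastBelow-correct n (λ k → walk? G k x y)
  ... | [ m ] | found = found
  ... | ⊤⁺    | none  = λ k w → let l , l<n , w′ = shorten k w in none l l<n w′

  record IsCoupling (μ₁ μ₂ : Fin n → ℝ) (π : Fin n → Fin n → ℝ) : Set where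
    field
      lower     : ∀ x y → 0ℝ ≤ π x y
      upper     : ∀ x y → π x y ≤ 1ℝ
      marginal₁ : ∀ x → ∑ (λ y → π x y) ≈ μ₁ x
      marginal₂ : ∀ y → ∑ (λ x → π x y) ≈ μ₂ y

  -- The summand d · p, where the value at d = ∞ is only correct if p ≈ 0.
  infixl 7 _·_
  _·_ : ℕ ⁺ → ℝ → ℝ
  [ d ] · p = fromℚ (+ d ℚ./ 1) * p
  ⊤⁺    · p = 0ℝ

  -- "The transport cost of π is finite and equals c".
  HasCost : (Fin n → Fin n → ℝ) → ℝ → Set
  HasCost π c = (∀ x y → dist x y ≡ ⊤⁺ → π x y ≈ 0ℝ) ×
                (c ≈ ∑ λ x → ∑ λ y → dist x y · π x y)

  -- Couplings of infinite cost do not affect a finite infimum.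
  IsW₁ : (μ₁ μ₂ : Fin n → ℝ) → ℝ → Set
  IsW₁ μ₁ μ₂ = IsInfimum λ c → ∃ λ π → IsCoupling μ₁ μ₂ π × HasCost π c

  μ : ℝ → (x : Fin n) .{{_ : ℕ.NonZero (degree G x)}} → Fin n → ℝ
  μ α x v with v Finₚ.≟ x | x ~? v
  ... | yes _ | _     = α
  ... | no  _ | yes _ = (1ℝ - α) * fromℚ (+ 1 ℚ./ degree G x)
  ... | no  _ | no  _ = 0ℝ

  IsOllivierRicci : ℝ → ∀ {x y} → x ~ y → ℝ → Set
  IsOllivierRicci α {x} {y} x~y k =
    ∃ λ w → IsW₁ (μ α x {{~⇒degree≢0 G x~y}}) (μ α y {{~⇒degree≢0 G (~-sym x~y)}}) w
          × k ≈ 1ℝ - w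

  -- κ is the limit of κ_α / (1 - α) as α ↑ 1, the curvature κ_α being given by
  -- the (functional up to ≈) relation above.
  IsLinLuYau : ∀ {x y} → x ~ y → ℝ → Set
  IsLinLuYau x~y κ =
    ∀ ε → 0ℝ < ε → ∃ λ δ → 0ℝ < δ ×
      (∀ α → 0ℝ ≤ α → 1ℝ - δ < α → (α<1 : α < 1ℝ) →
        ∃ λ κ_α → IsOllivierRicci α x~y κ_α ×
          (let q = κ_α * recip (1ℝ - α) (x<y⇒0<y-x α<1)
           in κ - ε < q × q < κ + ε))

  -- The curvature is a real-valued function of the edge: the limit exists and
  -- is unique, so κ below ranges over exactly one value up to ≈.
  Ric≥ : ℝ → Set
  Ric≥ k = ∀ {x y} (x~y : x ~ y) → ∀ κ → IsLinLuYau x~y κ → k ≤ κ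

{-# OPTIONS --safe #-}

-- Every κ_α with α = 1 - 1/K is nonnegative once some coupling of μ_x^α and μ_y^α
-- has cost at most 1.  In units of 1/(K d_x d_y) both measures are integral.  Say
-- d_x ≤ d_y, let A = N(x) ∖ B[y] and B = N(y) ∖ B[x], and let c be the number of
-- common neighbours.  Leave in place the mass common to both measures, move what is
-- possible from x to y, and move d_x units along each edge of a matching between A
-- and B of size |B| - c - 2; such a matching exists since the degree bound makes
-- the bipartite graph between A and B dense.  The rest may be paired arbitrarily:
-- any two vertices are at distance at most 2, so the cost is at most twice the
-- total mass minus what the chosen part saves, and that saving is at least the
-- total mass.

module Submission where

open import Data.Nat.Base as ℕ using (ℕ; zero; suc)
import Data.Nat.Properties as ℕₚ
open import Data.Nat.Tactic.RingSolver using (solve-∀)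
open import Data.Bool.Base using (if_then_else_)
open import Data.Fin.Base using (Fin; zero; suc)
open import Data.Fin.Properties using (_≟_; any?)
open import Data.List.Base using (length; filter; tabulate; map; allFin)
open import Data.List.Extrema.Nat using (min≤v⁺)
open import Data.List.Membership.Propositional.Properties using (∈-map⁺; ∈-allFin)
import Data.List.Relation.Unary.Any as Any
open import Data.Product.Base using (∃; _×_; _,_; proj₁; proj₂)
open import Data.Sum.Base using (inj₁; inj₂)
open import Relation.Nullary using (¬_; Dec; yes; no; does; contradiction)
open import Relation.Nullary.Decidable using (_×-dec_; ¬?)
open import Relation.Nullary.Construct.Add.Supremum using ([_]; ⊤⁺)
open import Relation.Unary using (Pred) renaming (Decidable to Decidable₁)
open import Relation.Binary.Core using (Rel)
open import Relation.Binary.Definitions using (Decidable)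
open import Relation.Binary.PropositionalEquality
open import Function.Base using (case_of_; _∘_)
open import Level using (0ℓ)
open import Algebra.Properties.Semiring.Sum ℕₚ.+-*-semiring
  using (sum; sum-cong-≗; sum-replicate-zero; ∑-distrib-+; ∑-comm; *-distribˡ-sum; *-distribʳ-sum)
open import Defs using (Graph; degree; dist; dist-correct; IsDistance; Walk; []; _∷_; ~⇒degree≢0)

-- Why the matching has `b - c - 2` edges, with `b = |B|`: against a cost of 2 per unit, mass left
-- in place saves 2 and mass moved along an edge saves 1. If `H` is the mass of the first measure at
-- `x`, then what stays and what goes from `x` to `y` save `2 (dx + dy + dx c) + H - dy`, while the
-- total mass is `H + dx dy` with `dy = 1 + c + b`. As `dx ≤ dy`, at most `dx (b - c - 2)` is
-- missing, which is what `b - c - 2` edges carrying `dx` each provide. The constant 2/3 enters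
-- through the existence of this matching. A matching of size `m` can be enlarged, by an edge or by
-- an augmenting path of length three, as soon as the degrees of a free `u` in `A` and a free `w` in
-- `B` within the bipartite graph add up to more than `m`. Bounding these two degrees from below by
-- counting complements costs `2 n`, paid by the bounds `1 + d ≥ 2n/3` at the three vertices `x`,
-- `u` and `w`. The curvature is a limit, so for each tolerance a single `α` close to 1 decides; a
-- rational one makes all masses multiples of one unit.

module Sums where

  -- Indicators and finite sums of natural numbers.

  open import Data.Nat.Base using (_+_; _*_; _∸_; _≤_; _<_; z≤n; s≤s)

  𝟙 : {P : Set} → Dec P → ℕ
  𝟙 P? = if does P? then 1 else 0

  indicated : {P : Set} (P? : Dec P) → 0 < 𝟙 P? → P
  indicated (yes p) _ = p

  𝟙-no : {P : Set} (P? : Dec P) → ¬ P → 𝟙 P? ≡ 0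
  𝟙-no (yes p) ¬p = contradiction p ¬p
  𝟙-no (no  _) _  = refl

  sum-mono : ∀ {n} {f g : Fin n → ℕ} → (∀ i → f i ≤ g i) → sum f ≤ sum g
  sum-mono {zero}  f≤g = z≤n
  sum-mono {suc n} f≤g = ℕₚ.+-mono-≤ (f≤g zero) (sum-mono λ i → f≤g (suc i))

  sum-<⇒∃< : ∀ {n} {f g : Fin n → ℕ} → sum f < sum g → ∃ λ i → f i < g i
  sum-<⇒∃< {zero} ()
  sum-<⇒∃< {suc n} {f} {g} Σf<Σg with f zero ℕₚ.<? g zero
  ... | yes f₀<g₀ = zero , f₀<g₀
  ... | no  f₀≮g₀ =
    let i , fᵢ<gᵢ = sum-<⇒∃< (ℕₚ.≰⇒> λ Σg≤Σf →
                      ℕₚ.<⇒≱ Σf<Σg (ℕₚ.+-mono-≤ (ℕₚ.≮⇒≥ f₀≮g₀) Σg≤Σf))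
    in suc i , fᵢ<gᵢ

  term≤sum : ∀ {n} (f : Fin n → ℕ) i → f i ≤ sum f
  term≤sum f zero    = ℕₚ.m≤m+n (f zero) _
  term≤sum f (suc i) = ℕₚ.≤-trans (term≤sum (λ j → f (suc j)) i) (ℕₚ.m≤n+m _ (f zero))

  sum-const-1 : ∀ n → sum {n} (λ _ → 1) ≡ n
  sum-const-1 zero    = refl
  sum-const-1 (suc n) = cong suc (sum-const-1 n)

  sum-𝟙* : ∀ {n} (v : Fin n) f → sum (λ w → 𝟙 (v ≟ w) * f w) ≡ f v
  sum-𝟙* {suc n} zero f = trans (cong₂ _+_ (ℕₚ.*-identityˡ (f zero)) (sum-replicate-zero n))
                                (ℕₚ.+-identityʳ (f zero))
  sum-𝟙* (suc v) f = sum-𝟙* v (λ w → f (suc w))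

  sum-𝟙 : ∀ {n} (v : Fin n) → sum (λ w → 𝟙 (v ≟ w)) ≡ 1
  sum-𝟙 v = trans (sum-cong-≗ λ w → sym (ℕₚ.*-identityʳ (𝟙 (v ≟ w)))) (sum-𝟙* v (λ _ → 1))

  𝟙-≟-sym : ∀ {n} (v w : Fin n) → 𝟙 (v ≟ w) ≡ 𝟙 (w ≟ v)
  𝟙-≟-sym v w with v ≟ w | w ≟ v
  ... | yes _   | yes _   = refl
  ... | no  _   | no  _   = refl
  ... | yes v≡w | no  w≢v = contradiction (sym v≡w) w≢v
  ... | no  v≢w | yes w≡v = contradiction (sym w≡v) v≢w

  𝟙+-mono : ∀ {n} {f g : Fin n → ℕ} u → f u < g u → (∀ i → f i ≤ g i) →
            ∀ i → 𝟙 (u ≟ i) + f i ≤ g i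
  𝟙+-mono u fᵤ<gᵤ f≤g i with u ≟ i
  ... | yes refl = fᵤ<gᵤ
  ... | no  _    = f≤g i

-- Integer matrices with bounded margins, and bipartite flows.

module Flows {n : ℕ} where
  open import Data.Nat.Base using (_+_; _*_; _∸_; _≤_; _<_; z≤n; s≤s)
  open Sums

  Matrix : Set
  Matrix = Fin n → Fin n → ℕ

  row col : Matrix → Fin n → ℕ
  row M i = sum (M i)
  col M j = sum (λ i → M i j)

  total : Matrix → ℕ
  total M = sum (row M)

  total≡sum-col : ∀ M → total M ≡ sum (col M)
  total≡sum-col = ∑-comm

  unit : Fin n → Fin n → Matrix
  unit u w i j = 𝟙 (u ≟ i) * 𝟙 (w ≟ j)

  infixr 5 _⊞_
  _⊞_ : Matrix → Matrix → Matrix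
  (M ⊞ N) i j = M i j + N i j

  row-⊞ : ∀ M N i → row (M ⊞ N) i ≡ row M i + row N i
  row-⊞ M N i = ∑-distrib-+ (M i) (N i)

  col-⊞ : ∀ M N j → col (M ⊞ N) j ≡ col M j + col N j
  col-⊞ M N j = ∑-distrib-+ (λ i → M i j) (λ i → N i j)

  total-⊞ : ∀ M N → total (M ⊞ N) ≡ total M + total N
  total-⊞ M N = trans (sum-cong-≗ (row-⊞ M N)) (∑-distrib-+ (row M) (row N))

  row-unit : ∀ u w i → row (unit u w) i ≡ 𝟙 (u ≟ i)
  row-unit u w i = begin
    sum (λ j → 𝟙 (u ≟ i) * 𝟙 (w ≟ j))  ≡⟨ *-distribˡ-sum (𝟙 (u ≟ i)) (λ j → 𝟙 (w ≟ j)) ⟨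
    𝟙 (u ≟ i) * sum (λ j → 𝟙 (w ≟ j))  ≡⟨ cong (𝟙 (u ≟ i) *_) (sum-𝟙 w) ⟩
    𝟙 (u ≟ i) * 1                      ≡⟨ ℕₚ.*-identityʳ _ ⟩
    𝟙 (u ≟ i)                          ∎
    where open ≡-Reasoning

  col-unit : ∀ u w j → col (unit u w) j ≡ 𝟙 (w ≟ j)
  col-unit u w j = trans (sum-cong-≗ λ i → ℕₚ.*-comm (𝟙 (u ≟ i)) (𝟙 (w ≟ j))) (row-unit w u j)

  total-unit : ∀ u w → total (unit u w) ≡ 1
  total-unit u w = trans (sum-cong-≗ (row-unit u w)) (sum-𝟙 u)

  row-unit-⊞ : ∀ u w M i → row (unit u w ⊞ M) i ≡ 𝟙 (u ≟ i) + row M i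
  row-unit-⊞ u w M i = trans (row-⊞ (unit u w) M i) (cong (_+ row M i) (row-unit u w i))

  col-unit-⊞ : ∀ u w M j → col (unit u w ⊞ M) j ≡ 𝟙 (w ≟ j) + col M j
  col-unit-⊞ u w M j = trans (col-⊞ (unit u w) M j) (cong (_+ col M j) (col-unit u w j))

  total-unit-⊞ : ∀ u w M → total (unit u w ⊞ M) ≡ suc (total M)
  total-unit-⊞ u w M = trans (total-⊞ (unit u w) M) (cong (_+ total M) (total-unit u w))

  -- Stating the removal as a sum lets the margins of `M′` be compared with those of `M` without
  -- truncated subtraction.
  remove-unit : ∀ {M : Matrix} u w → 0 < M u w → ∃ λ M′ → ∀ i j → M i j ≡ (unit u w ⊞ M′) i j
  remove-unit {M} u w 0<M = (λ i j → M i j ∸ unit u w i j) , λ i j →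
    sym (ℕₚ.m+[n∸m]≡n (unit≤ i j))
    where
    unit≤ : ∀ i j → unit u w i j ≤ M i j
    unit≤ i j with u ≟ i | w ≟ j
    ... | yes refl | yes refl = 0<M
    ... | yes _    | no  _    = z≤n
    ... | no  _    | _        = z≤n

  diagonal : (Fin n → ℕ) → Matrix
  diagonal f i j = 𝟙 (i ≟ j) * f i

  row-diagonal : ∀ f i → row (diagonal f) i ≡ f i
  row-diagonal f i = sum-𝟙* i (λ _ → f i)

  col-diagonal : ∀ f j → col (diagonal f) j ≡ f j
  col-diagonal f j = trans (sum-cong-≗ λ i → cong (_* f i) (𝟙-≟-sym i j)) (sum-𝟙* j f)

  infixr 6 _⊙_
  _⊙_ : ℕ → Matrix → Matrix
  (k ⊙ M) i j = k * M i j

  row-⊙ : ∀ k M i → row (k ⊙ M) i ≡ k * row M i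
  row-⊙ k M i = sym (*-distribˡ-sum k (M i))

  col-⊙ : ∀ k M j → col (k ⊙ M) j ≡ k * col M j
  col-⊙ k M j = sym (*-distribˡ-sum k (λ i → M i j))

  total-⊙ : ∀ k M → total (k ⊙ M) ≡ k * total M
  total-⊙ k M = trans (sum-cong-≗ (row-⊙ k M)) (sym (*-distribˡ-sum k (row M)))

  total-mono : ∀ {M N : Matrix} → (∀ i j → M i j ≤ N i j) → total M ≤ total N
  total-mono M≤N = sum-mono λ i → sum-mono (M≤N i)

  record Fits (A B : Fin n → ℕ) (M : Matrix) : Set where
    field
      row≤ : ∀ i → row M i ≤ A i
      col≤ : ∀ j → col M j ≤ B j

  open Fits public

  fits-unit-⊞ : ∀ {A B M} u w → row M u < A u → col M w < B w → Fits A B M →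
                Fits A B (unit u w ⊞ M)
  fits-unit-⊞ {A} {B} {M} u w rowᵤ< col𝓌< fits = record
    { row≤ = λ i → subst (_≤ A i) (sym (row-unit-⊞ u w M i)) (𝟙+-mono u rowᵤ< (row≤ fits) i)
    ; col≤ = λ j → subst (_≤ B j) (sym (col-unit-⊞ u w M j)) (𝟙+-mono w col𝓌< (col≤ fits) j)
    }

  unsaturated-row : ∀ {A} M → total M < sum A → ∃ λ u → row M u < A u
  unsaturated-row _ = sum-<⇒∃<

  unsaturated-col : ∀ {B} M → total M < sum B → ∃ λ w → col M w < B w
  unsaturated-col {B} M lt = sum-<⇒∃< (subst (_< sum B) (total≡sum-col M) lt)

  -- If `f i < g i`, then `f` raised by one at `i` still lies below `g`, which makes the sum of `f`
  -- strictly smaller.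
  saturated : ∀ {f g : Fin n → ℕ} → (∀ i → f i ≤ g i) → sum g ≤ sum f → ∀ i → f i ≡ g i
  saturated {f} {g} f≤g Σg≤Σf i with f i ℕₚ.<? g i
  ... | no  fᵢ≮gᵢ = ℕₚ.≤-antisym (f≤g i) (ℕₚ.≮⇒≥ fᵢ≮gᵢ)
  ... | yes fᵢ<gᵢ = contradiction Σg≤Σf (ℕₚ.<⇒≱ (begin-strict
    sum f                          <⟨ ℕₚ.n<1+n _ ⟩
    1 + sum f                      ≡⟨ cong (_+ sum f) (sum-𝟙 i) ⟨
    sum (λ j → 𝟙 (i ≟ j)) + sum f  ≡⟨ ∑-distrib-+ (λ j → 𝟙 (i ≟ j)) f ⟨
    sum (λ j → 𝟙 (i ≟ j) + f j)    ≤⟨ sum-mono (𝟙+-mono i fᵢ<gᵢ f≤g) ⟩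
    sum g                          ∎))
    where open ℕₚ.≤-Reasoning

  -- Greedy filling, by recursion on the missing mass `r`: while it is positive, some row has room
  -- and, the totals being equal, so does some column; one unit goes there. When nothing is missing,
  -- the margin inequalities are forced to be equalities.
  complete : ∀ {S T} → sum S ≡ sum T → ∀ r {θ} → Fits S T θ → total θ + r ≡ sum S →
             ∃ λ π → (∀ i → row π i ≡ S i) × (∀ j → col π j ≡ T j) × (∀ i j → θ i j ≤ π i j)
  complete {S} {T} S≡T zero {θ} fits θ≡S =
    θ , saturated (row≤ fits) (ℕₚ.≤-reflexive (sym Σθ≡S)) ,
    saturated (col≤ fits) (ℕₚ.≤-reflexive (trans (sym S≡T) (trans (sym Σθ≡S) (total≡sum-col θ)))) ,
    λ _ _ → ℕₚ.≤-refl
    where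
    Σθ≡S : total θ ≡ sum S
    Σθ≡S = trans (sym (ℕₚ.+-identityʳ _)) θ≡S
  complete {S} {T} S≡T (suc r) {θ} fits θ+r≡S =
    let u , rowᵤ< = unsaturated-row θ Σθ<S
        w , col𝓌< = unsaturated-col θ (subst (total θ <_) S≡T Σθ<S)
        π , row≡ , col≡ , θ′≤π = complete S≡T r (fits-unit-⊞ u w rowᵤ< col𝓌< fits)
          (trans (cong (_+ r) (total-unit-⊞ u w θ)) (trans (sym (ℕₚ.+-suc (total θ) r)) θ+r≡S))
    in π , row≡ , col≡ , λ i j → ℕₚ.≤-trans (ℕₚ.m≤n+m (θ i j) (unit u w i j)) (θ′≤π i j)
    where
    Σθ<S : total θ < sum S
    Σθ<S = subst (total θ <_) θ+r≡S (ℕₚ.m<m+n (total θ) ℕ.z<s)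

  module _ {_⟶_ : Rel (Fin n) 0ℓ} (_⟶?_ : Decidable _⟶_) (A B : Fin n → ℕ) where

    -- An integral flow of value `m` in a bipartite network with supplies `A` and demands `B`. For
    -- 0-1 capacities this is a matching of size `m`, and `out` and `into` below are the degrees in
    -- the bipartite graph.
    record Flow (m : ℕ) : Set where
      field
        flow    : Matrix
        fits    : Fits A B flow
        along   : ∀ i j → 0 < flow i j → i ⟶ j
        total≡m : total flow ≡ m

    open Flow public

    out into : Fin n → ℕ
    out u = sum (λ j → B j * 𝟙 (u ⟶? j))
    into w = sum (λ i → A i * 𝟙 (i ⟶? w))

    private
      along-unit-⊞ : ∀ {M} u w → u ⟶ w → (∀ i j → 0 < M i j → i ⟶ j) →
                     ∀ i j → 0 < (unit u w ⊞ M) i j → i ⟶ j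
      along-unit-⊞ u w u⟶w M⟶ i j 0< with u ≟ i | w ≟ j
      ... | yes refl | yes refl = u⟶w
      ... | yes _    | no  _    = M⟶ i j 0<
      ... | no  _    | _        = M⟶ i j 0<

      insert : ∀ {m} (F : Flow m) u w → row (flow F) u < A u → col (flow F) w < B w → u ⟶ w →
               Flow (suc m)
      insert F u w rowᵤ< col𝓌< u⟶w = record
        { flow    = unit u w ⊞ flow F
        ; fits    = fits-unit-⊞ u w rowᵤ< col𝓌< (fits F)
        ; along   = along-unit-⊞ u w u⟶w (along F)
        ; total≡m = trans (total-unit-⊞ u w (flow F)) (cong suc (total≡m F))
        }

      -- Flips the augmenting path `u`, `j`, `i`, `w`: a unit on `i ⟶ j` is traded for one on
      -- `u ⟶ j` and one on `i ⟶ w`. The row of `i` and the column of `j` keep their sums, so only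
      -- the margins at `u` and `w` grow.
      reroute : ∀ {m} (F : Flow m) u w i j → row (flow F) u < A u → col (flow F) w < B w →
                0 < flow F i j → u ⟶ j → i ⟶ w → Flow (suc m)
      reroute {m} F u w i j rowᵤ< col𝓌< 0<Fᵢⱼ u⟶j i⟶w = record
        { flow    = M′
        ; fits    = record
          { row≤ = λ k → subst (_≤ A k) (sym (row≡ k)) (𝟙+-mono u rowᵤ< (row≤ (fits F)) k)
          ; col≤ = λ k → subst (_≤ B k) (sym (col≡ k)) (𝟙+-mono w col𝓌< (col≤ (fits F)) k)
          }
        ; along   = along-unit-⊞ u j u⟶j (along-unit-⊞ i w i⟶w
                      λ k l 0<M⁻ → along F k l (ℕₚ.<-≤-trans 0<M⁻ (M⁻≤M k l)))
        ; total≡m = begin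
            total M′                       ≡⟨ sum-cong-≗ row≡ ⟩
            sum (λ k → 𝟙 (u ≟ k) + row M k) ≡⟨ ∑-distrib-+ (λ k → 𝟙 (u ≟ k)) (row M) ⟩
            sum (λ k → 𝟙 (u ≟ k)) + total M ≡⟨ cong₂ _+_ (sum-𝟙 u) (total≡m F) ⟩
            suc m                          ∎
        }
        where
        open ≡-Reasoning
        M = flow F
        M⁻ = proj₁ (remove-unit {M} i j 0<Fᵢⱼ)
        M≡ = proj₂ (remove-unit {M} i j 0<Fᵢⱼ)
        M′ = unit u j ⊞ unit i w ⊞ M⁻
        row≡ : ∀ k → row M′ k ≡ 𝟙 (u ≟ k) + row M k
        row≡ k = begin
          row M′ k                                 ≡⟨ row-unit-⊞ u j (unit i w ⊞ M⁻) k ⟩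
          𝟙 (u ≟ k) + row (unit i w ⊞ M⁻) k        ≡⟨ cong (𝟙 (u ≟ k) +_) (row-unit-⊞ i w M⁻ k) ⟩
          𝟙 (u ≟ k) + (𝟙 (i ≟ k) + row M⁻ k)       ≡⟨ cong (𝟙 (u ≟ k) +_) (row-unit-⊞ i j M⁻ k) ⟨
          𝟙 (u ≟ k) + row (unit i j ⊞ M⁻) k        ≡⟨ cong (𝟙 (u ≟ k) +_) (sum-cong-≗ (M≡ k)) ⟨
          𝟙 (u ≟ k) + row M k                      ∎
        col≡ : ∀ k → col M′ k ≡ 𝟙 (w ≟ k) + col M k
        col≡ k = begin
          col M′ k                                 ≡⟨ col-unit-⊞ u j (unit i w ⊞ M⁻) k ⟩
          𝟙 (j ≟ k) + col (unit i w ⊞ M⁻) k        ≡⟨ cong (𝟙 (j ≟ k) +_) (col-unit-⊞ i w M⁻ k) ⟩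
          𝟙 (j ≟ k) + (𝟙 (w ≟ k) + col M⁻ k)       ≡⟨ swap (𝟙 (j ≟ k)) (𝟙 (w ≟ k)) (col M⁻ k) ⟩
          𝟙 (w ≟ k) + (𝟙 (j ≟ k) + col M⁻ k)       ≡⟨ cong (𝟙 (w ≟ k) +_) (col-unit-⊞ i j M⁻ k) ⟨
          𝟙 (w ≟ k) + col (unit i j ⊞ M⁻) k        ≡⟨ cong (𝟙 (w ≟ k) +_) (sum-cong-≗ λ l → M≡ l k) ⟨
          𝟙 (w ≟ k) + col M k                      ∎
          where
          swap : ∀ a b c → a + (b + c) ≡ b + (a + c)
          swap = solve-∀
        M⁻≤M : ∀ k l → M⁻ k l ≤ M k l
        M⁻≤M k l = subst (M⁻ k l ≤_) (sym (M≡ k l)) (ℕₚ.m≤n+m _ (unit i j k l))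

    -- If no edge at the unsaturated vertices u and w can be added, then all
    -- targets of u and all sources of w are saturated, and by counting some unit
    -- i → j of the flow has u ⟶ j and i ⟶ w; the augmenting path u j i w exists.
    augment : ∀ {m} → Flow m → m < sum A → m < sum B →
              (∀ u w → 0 < A u → 0 < B w → m < out u + into w) → Flow (suc m)
    augment {m} F m<ΣA m<ΣB m<out+in =
      case any? (λ j → (u ⟶? j) ×-dec (col M j ℕₚ.<? B j)) of λ where
        (yes (j , u⟶j , colⱼ<)) → insert F u j rowᵤ< colⱼ< u⟶j
        (no  ¬out) → case any? (λ i → (i ⟶? w) ×-dec (row M i ℕₚ.<? A i)) of λ where
          (yes (i , i⟶w , rowᵢ<)) → insert F i w rowᵢ< col𝓌< i⟶w
          (no  ¬in) →
            let i , rowᵢ<ᵢ = sum-<⇒∃< (overfull ¬out ¬in)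
                j , Mᵢⱼ<   = sum-<⇒∃< rowᵢ<ᵢ
                0<Mᵢⱼ , u⟶j , i⟶w = both i j Mᵢⱼ<
            in reroute F u w i j rowᵤ< col𝓌< 0<Mᵢⱼ u⟶j i⟶w
      where
      M = flow F
      u∃ = unsaturated-row M (subst (_< sum A) (sym (total≡m F)) m<ΣA)
      w∃ = unsaturated-col M (subst (_< sum B) (sym (total≡m F)) m<ΣB)
      u = proj₁ u∃
      w = proj₁ w∃
      rowᵤ< = proj₂ u∃
      col𝓌< = proj₂ w∃

      -- The indicators are 0 or 1, and the right side exceeds `M i j` only when both are 1 and
      -- `M i j` is positive.
      both : ∀ i j → M i j < M i j * 𝟙 (u ⟶? j) + M i j * 𝟙 (i ⟶? w) →
             0 < M i j × u ⟶ j × i ⟶ w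
      both i j lt with M i j | u ⟶? j | i ⟶? w
      ... | suc _ | yes u⟶j | yes i⟶w = ℕ.z<s , u⟶j , i⟶w
      ... | k | no _  | no _  = contradiction (subst (k <_) (neither k) lt) ℕₚ.n≮0
        where neither : ∀ k → k * 0 + k * 0 ≡ 0
              neither = solve-∀
      ... | k | yes _ | no _  = contradiction (subst (k <_) (left k) lt) (ℕₚ.n≮n k)
        where left : ∀ k → k * 1 + k * 0 ≡ k
              left = solve-∀
      ... | k | no _  | yes _ = contradiction (subst (k <_) (right k) lt) (ℕₚ.n≮n k)
        where right : ∀ k → k * 0 + k * 1 ≡ k
              right = solve-∀
      ... | zero | yes _ | yes _ = contradiction lt (ℕₚ.n≮n 0)

      module _ (¬out : ¬ (∃ λ j → u ⟶ j × col M j < B j))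
               (¬in  : ¬ (∃ λ i → i ⟶ w × row M i < A i)) where
        -- Every target of `u` is saturated, so its capacity equals the flow arriving there; `in≤`
        -- is the mirror image.
        out≤ : out u ≤ sum (λ j → sum (λ i → M i j * 𝟙 (u ⟶? j)))
        out≤ = sum-mono λ j → ℕₚ.≤-trans (pointwise j)
                 (ℕₚ.≤-reflexive (*-distribʳ-sum (𝟙 (u ⟶? j)) (λ i → M i j)))
          where
          pointwise : ∀ j → B j * 𝟙 (u ⟶? j) ≤ col M j * 𝟙 (u ⟶? j)
          pointwise j with u ⟶? j
          ... | yes u⟶j = ℕₚ.*-monoˡ-≤ 1 (ℕₚ.≮⇒≥ λ lt → ¬out (j , u⟶j , lt))
          ... | no  _   = ℕₚ.≤-reflexive (trans (ℕₚ.*-zeroʳ (B j)) (sym (ℕₚ.*-zeroʳ (col M j))))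

        in≤ : into w ≤ sum (λ i → sum (λ j → M i j * 𝟙 (i ⟶? w)))
        in≤ = sum-mono λ i → ℕₚ.≤-trans (pointwise i)
                (ℕₚ.≤-reflexive (*-distribʳ-sum (𝟙 (i ⟶? w)) (M i)))
          where
          pointwise : ∀ i → A i * 𝟙 (i ⟶? w) ≤ row M i * 𝟙 (i ⟶? w)
          pointwise i with i ⟶? w
          ... | yes i⟶w = ℕₚ.*-monoˡ-≤ 1 (ℕₚ.≮⇒≥ λ lt → ¬in (i , i⟶w , lt))
          ... | no  _   = ℕₚ.≤-reflexive (trans (ℕₚ.*-zeroʳ (A i)) (sym (ℕₚ.*-zeroʳ (row M i))))

        overfull : total M < total (λ i j → M i j * 𝟙 (u ⟶? j) + M i j * 𝟙 (i ⟶? w))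
        overfull = begin-strict
          total M
            ≡⟨ total≡m F ⟩
          m
            <⟨ m<out+in u w (ℕₚ.≤-<-trans z≤n rowᵤ<) (ℕₚ.≤-<-trans z≤n col𝓌<) ⟩
          out u + into w
            ≤⟨ ℕₚ.+-mono-≤ out≤ in≤ ⟩
          sum (λ j → sum (λ i → M i j * 𝟙 (u ⟶? j))) + total (λ i j → M i j * 𝟙 (i ⟶? w))
            ≡⟨ cong (_+ total (λ i j → M i j * 𝟙 (i ⟶? w)))
                    (∑-comm (λ i j → M i j * 𝟙 (u ⟶? j))) ⟨
          total (λ i j → M i j * 𝟙 (u ⟶? j)) + total (λ i j → M i j * 𝟙 (i ⟶? w))
            ≡⟨ total-⊞ (λ i j → M i j * 𝟙 (u ⟶? j)) (λ i j → M i j * 𝟙 (i ⟶? w)) ⟨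
          total (λ i j → M i j * 𝟙 (u ⟶? j) + M i j * 𝟙 (i ⟶? w))  ∎
          where open ℕₚ.≤-Reasoning

    empty : Flow 0
    empty = record
      { flow    = λ _ _ → 0
      ; fits    = record { row≤ = λ i → subst (_≤ A i) (sym (sum-replicate-zero n)) z≤n
                         ; col≤ = λ j → subst (_≤ B j) (sym (sum-replicate-zero n)) z≤n }
      ; along   = λ _ _ ()
      ; total≡m = trans (sum-cong-≗ {n} λ _ → sum-replicate-zero n) (sum-replicate-zero n)
      }

    flow-of-value : ∀ t → (∀ m → m < t → m < sum A × m < sum B ×
                            (∀ u w → 0 < A u → 0 < B w → m < out u + into w)) → Flow t
    flow-of-value zero    _   = empty
    flow-of-value (suc t) hyp =
      let t<ΣA , t<ΣB , t<out+in = hyp t (ℕₚ.n<1+n t)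
      in augment (flow-of-value t λ m m<t → hyp m (ℕₚ.m<n⇒m<1+n m<t)) t<ΣA t<ΣB t<out+in

-- Counting in the neighbourhoods of two vertices; distances truncated at 2.

module Neighbourhoods {n : ℕ} (G : Graph n) where
  open import Data.Nat.Base using (_+_; _*_; _∸_; _≤_; _<_; z≤n; s≤s)
  open Graph G
  open Sums

  length-filter-tabulate : ∀ {m} {A : Set} {P : Pred A 0ℓ} (P? : Decidable₁ P) (f : Fin m → A) →
    length (filter P? (tabulate f)) ≡ sum (λ i → 𝟙 (P? (f i)))
  length-filter-tabulate {zero}  P? f = refl
  length-filter-tabulate {suc m} P? f with P? (f zero)
  ... | yes _ = cong suc (length-filter-tabulate P? (f ∘ suc))
  ... | no  _ = length-filter-tabulate P? (f ∘ suc)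

  degree≡sum : ∀ v → degree G v ≡ sum (λ w → 𝟙 (v ~? w))
  degree≡sum v = length-filter-tabulate (v ~?_) (λ i → i)

  Only : Fin n → Fin n → Fin n → Set
  Only x y v = x ~ v × ¬ y ~ v × ¬ y ≡ v

  only? : ∀ x y v → Dec (Only x y v)
  only? x y v = (x ~? v) ×-dec ¬? (y ~? v) ×-dec ¬? (y ≟ v)

  both? : ∀ x y v → Dec (x ~ v × y ~ v)
  both? x y v = (x ~? v) ×-dec (y ~? v)

  common only : Fin n → Fin n → ℕ
  common x y = sum (λ v → 𝟙 (both? x y v))
  only x y   = sum (λ v → 𝟙 (only? x y v))

  both-comm : ∀ x y v → 𝟙 (both? x y v) ≡ 𝟙 (both? y x v)
  both-comm x y v with x ~? v | y ~? v
  ... | yes _ | yes _ = refl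
  ... | yes _ | no  _ = refl
  ... | no  _ | yes _ = refl
  ... | no  _ | no  _ = refl

  common-comm : ∀ x y → common x y ≡ common y x
  common-comm x y = sum-cong-≗ (both-comm x y)

  sum-+3 : ∀ {m} (f g h : Fin m → ℕ) →
           sum (λ i → f i + (g i + h i)) ≡ sum f + (sum g + sum h)
  sum-+3 f g h = trans (∑-distrib-+ f (λ i → g i + h i)) (cong (sum f +_) (∑-distrib-+ g h))

  neighbours-split : ∀ {x y} → x ~ y → ∀ v →
    𝟙 (x ~? v) ≡ 𝟙 (y ≟ v) + (𝟙 (both? x y v) + 𝟙 (only? x y v))
  neighbours-split {x} {y} x~y v with y ≟ v
  neighbours-split {x} {y} x~y v | yes refl with x ~? v | v ~? v
  ... | no x≁y | _       = contradiction x~y x≁y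
  ... | yes _  | yes v~v = contradiction v~v ~-irrefl
  ... | yes _  | no _    = refl
  neighbours-split {x} {y} x~y v | no _ with x ~? v | y ~? v
  ... | yes _ | yes _ = refl
  ... | yes _ | no  _ = refl
  ... | no  _ | _     = refl

  degree-split : ∀ {x y} → x ~ y → degree G x ≡ 1 + (common x y + only x y)
  degree-split {x} {y} x~y = begin
    degree G x                 ≡⟨ degree≡sum x ⟩
    sum (λ v → 𝟙 (x ~? v))     ≡⟨ sum-cong-≗ (neighbours-split x~y) ⟩
    sum (λ v → 𝟙 (y ≟ v) + (𝟙 (both? x y v) + 𝟙 (only? x y v)))
      ≡⟨ sum-+3 (λ v → 𝟙 (y ≟ v)) (λ v → 𝟙 (both? x y v)) (λ v → 𝟙 (only? x y v)) ⟩
    sum (λ v → 𝟙 (y ≟ v)) + (common x y + only x y)  ≡⟨ cong (_+ (common x y + only x y)) (sum-𝟙 y) ⟩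
    1 + (common x y + only x y)  ∎
    where open ≡-Reasoning

  degree+degree≤ : ∀ x y → degree G x + degree G y ≤ n + common x y
  degree+degree≤ x y = begin
    degree G x + degree G y               ≡⟨ cong₂ _+_ (degree≡sum x) (degree≡sum y) ⟩
    sum (λ v → 𝟙 (x ~? v)) + sum (λ v → 𝟙 (y ~? v))
      ≡⟨ ∑-distrib-+ (λ v → 𝟙 (x ~? v)) (λ v → 𝟙 (y ~? v)) ⟨
    sum (λ v → 𝟙 (x ~? v) + 𝟙 (y ~? v))   ≤⟨ sum-mono pointwise ⟩
    sum (λ v → 1 + 𝟙 (both? x y v))       ≡⟨ ∑-distrib-+ {n} (λ _ → 1) (λ v → 𝟙 (both? x y v)) ⟩
    sum {n} (λ _ → 1) + common x y            ≡⟨ cong (_+ common x y) (sum-const-1 n) ⟩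
    n + common x y                        ∎
    where
    open ℕₚ.≤-Reasoning
    pointwise : ∀ v → 𝟙 (x ~? v) + 𝟙 (y ~? v) ≤ 1 + 𝟙 (both? x y v)
    pointwise v with x ~? v | y ~? v
    ... | yes _ | yes _ = ℕₚ.≤-refl
    ... | yes _ | no  _ = ℕₚ.≤-refl
    ... | no  _ | yes _ = ℕₚ.≤-refl
    ... | no  _ | no  _ = z≤n

  -- Inclusion-exclusion for the two neighbourhoods; `v` and `w` lie outside both of them and
  -- account for the 2.
  nonadjacent-degree+degree≤ : ∀ {v w} → ¬ v ≡ w → ¬ v ~ w →
    degree G v + degree G w + 2 ≤ n + common v w
  nonadjacent-degree+degree≤ {v} {w} v≢w v≁w = begin
    degree G v + degree G w + 2
      ≡⟨ cong₂ _+_ (cong₂ _+_ (degree≡sum v) (degree≡sum w)) (sym (cong₂ _+_ (sum-𝟙 v) (sum-𝟙 w))) ⟩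
    (sum (λ z → 𝟙 (v ~? z)) + sum (λ z → 𝟙 (w ~? z))) + (sum (λ z → 𝟙 (v ≟ z)) + sum (λ z → 𝟙 (w ≟ z)))
      ≡⟨ cong₂ _+_ (sym (∑-distrib-+ (λ z → 𝟙 (v ~? z)) (λ z → 𝟙 (w ~? z))))
                   (sym (∑-distrib-+ (λ z → 𝟙 (v ≟ z)) (λ z → 𝟙 (w ≟ z)))) ⟩
    sum (λ z → 𝟙 (v ~? z) + 𝟙 (w ~? z)) + sum (λ z → 𝟙 (v ≟ z) + 𝟙 (w ≟ z))
      ≡⟨ ∑-distrib-+ (λ z → 𝟙 (v ~? z) + 𝟙 (w ~? z)) (λ z → 𝟙 (v ≟ z) + 𝟙 (w ≟ z)) ⟨
    sum (λ z → (𝟙 (v ~? z) + 𝟙 (w ~? z)) + (𝟙 (v ≟ z) + 𝟙 (w ≟ z)))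
      ≤⟨ sum-mono pointwise ⟩
    sum (λ z → 1 + 𝟙 (both? v w z))       ≡⟨ ∑-distrib-+ {n} (λ _ → 1) (λ z → 𝟙 (both? v w z)) ⟩
    sum {n} (λ _ → 1) + common v w            ≡⟨ cong (_+ common v w) (sum-const-1 n) ⟩
    n + common v w                        ∎
    where
    open ℕₚ.≤-Reasoning
    pointwise : ∀ z → (𝟙 (v ~? z) + 𝟙 (w ~? z)) + (𝟙 (v ≟ z) + 𝟙 (w ≟ z)) ≤ 1 + 𝟙 (both? v w z)
    pointwise z with v ≟ z | w ≟ z
    pointwise z | yes refl | yes w≡v = contradiction (sym w≡v) v≢w
    pointwise z | yes refl | no _ with v ~? v | w ~? v
    ... | yes v~v | _ = contradiction v~v ~-irrefl
    ... | no _ | yes w~v = contradiction (~-sym w~v) v≁w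
    ... | no _ | no _ = ℕₚ.≤-refl
    pointwise z | no _ | yes refl with v ~? w | w ~? w
    ... | yes v~w | _ = contradiction v~w v≁w
    ... | no _ | yes w~w = contradiction w~w ~-irrefl
    ... | no _ | no _ = ℕₚ.≤-refl
    pointwise z | no _ | no _ with v ~? z | w ~? z
    ... | yes _ | yes _ = ℕₚ.≤-refl
    ... | yes _ | no  _ = ℕₚ.≤-refl
    ... | no  _ | yes _ = ℕₚ.≤-refl
    ... | no  _ | no  _ = z≤n

  -- Counting vertices outside N(u) or outside N(y) ∖ B[x]: u and y are outside both.
  only-neighbours : ∀ {x y u} → Only x y u →
    only y x + degree G u + 2 ≤ sum (λ w → 𝟙 (only? y x w) * 𝟙 (u ~? w)) + n
  only-neighbours {x} {y} {u} (x~u , y≁u , y≢u) = begin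
    only y x + degree G u + 2
      ≡⟨ cong₂ _+_ (cong (only y x +_) (degree≡sum u)) (sym (cong₂ _+_ (sum-𝟙 u) (sum-𝟙 y))) ⟩
    (only y x + sum (λ w → 𝟙 (u ~? w))) + (sum (λ w → 𝟙 (u ≟ w)) + sum (λ w → 𝟙 (y ≟ w)))
      ≡⟨ cong₂ _+_ (sym (∑-distrib-+ (λ w → 𝟙 (only? y x w)) (λ w → 𝟙 (u ~? w))))
                   (sym (∑-distrib-+ (λ w → 𝟙 (u ≟ w)) (λ w → 𝟙 (y ≟ w)))) ⟩
    sum (λ w → 𝟙 (only? y x w) + 𝟙 (u ~? w)) + sum (λ w → 𝟙 (u ≟ w) + 𝟙 (y ≟ w))
      ≡⟨ ∑-distrib-+ (λ w → 𝟙 (only? y x w) + 𝟙 (u ~? w)) (λ w → 𝟙 (u ≟ w) + 𝟙 (y ≟ w)) ⟨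
    sum (λ w → (𝟙 (only? y x w) + 𝟙 (u ~? w)) + (𝟙 (u ≟ w) + 𝟙 (y ≟ w)))
      ≤⟨ sum-mono pointwise ⟩
    sum (λ w → 𝟙 (only? y x w) * 𝟙 (u ~? w) + 1)
      ≡⟨ ∑-distrib-+ {n} (λ w → 𝟙 (only? y x w) * 𝟙 (u ~? w)) (λ _ → 1) ⟩
    sum (λ w → 𝟙 (only? y x w) * 𝟙 (u ~? w)) + sum {n} (λ _ → 1)
      ≡⟨ cong (sum (λ w → 𝟙 (only? y x w) * 𝟙 (u ~? w)) +_) (sum-const-1 n) ⟩
    sum (λ w → 𝟙 (only? y x w) * 𝟙 (u ~? w)) + n  ∎
    where
    open ℕₚ.≤-Reasoning
    pointwise : ∀ w → (𝟙 (only? y x w) + 𝟙 (u ~? w)) + (𝟙 (u ≟ w) + 𝟙 (y ≟ w))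
                      ≤ 𝟙 (only? y x w) * 𝟙 (u ~? w) + 1
    pointwise w = bound (only? y x w) (u ~? w) (u ≟ w) (y ≟ w)
      where
      bound : (p : Dec (Only y x w)) (q : Dec (u ~ w)) (r : Dec (u ≡ w)) (s : Dec (y ≡ w)) →
              (𝟙 p + 𝟙 q) + (𝟙 r + 𝟙 s) ≤ 𝟙 p * 𝟙 q + 1
      bound _                   _         (yes refl) (yes refl) = contradiction refl y≢u
      bound (yes (_ , x≁u , _)) _         (yes refl) (no  _)    = contradiction x~u x≁u
      bound (no _)              (yes u~u) (yes refl) (no  _)    = contradiction u~u ~-irrefl
      bound (no _)              (no  _)   (yes refl) (no  _)    = ℕₚ.≤-refl
      bound (yes (y~y , _))     _         (no  _)    (yes refl) = contradiction y~y ~-irrefl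
      bound (no _)              (yes u~y) (no  _)    (yes refl) = contradiction (~-sym u~y) y≁u
      bound (no _)              (no  _)   (no  _)    (yes refl) = ℕₚ.≤-refl
      bound (yes _)             (yes _)   (no  _)    (no  _)    = ℕₚ.≤-refl
      bound (yes _)             (no  _)   (no  _)    (no  _)    = ℕₚ.≤-refl
      bound (no  _)             (yes _)   (no  _)    (no  _)    = ℕₚ.≤-refl
      bound (no  _)             (no  _)   (no  _)    (no  _)    = z≤n

  𝟙-~-sym : ∀ v w → 𝟙 (v ~? w) ≡ 𝟙 (w ~? v)
  𝟙-~-sym v w with v ~? w | w ~? v
  ... | yes _   | yes _   = refl
  ... | no  _   | no  _   = refl
  ... | yes v~w | no  w≁v = contradiction (~-sym v~w) w≁v
  ... | no  v≁w | yes w~v = contradiction (~-sym w~v) v≁w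

  -- The minimum of the graph distance and 2, as a closed formula.
  hops : Fin n → Fin n → ℕ
  hops v w = if does (v ≟ w) then 0 else if does (v ~? w) then 1 else 2

  hops-sym : ∀ v w → hops v w ≡ hops w v
  hops-sym v w with v ≟ w | w ≟ v | v ~? w | w ~? v
  ... | yes _    | yes _    | _       | _       = refl
  ... | yes refl | no  v≢v  | _       | _       = contradiction refl v≢v
  ... | no  v≢v  | yes refl | _       | _       = contradiction refl v≢v
  ... | no  _    | no  _    | yes _   | yes _   = refl
  ... | no  _    | no  _    | no  _   | no  _   = refl
  ... | no  _    | no  _    | yes v~w | no  w≁v = contradiction (~-sym v~w) w≁v
  ... | no  _    | no  _    | no  v≁w | yes w~v = contradiction (~-sym w~v) v≁w

  -- What a unit of mass gains over the worst distance 2.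
  saving : Fin n → Fin n → ℕ
  saving v w = 2 ∸ hops v w

  saving+hops : ∀ v w → saving v w + hops v w ≡ 2
  saving+hops v w with v ≟ w | v ~? w
  ... | yes _ | _     = refl
  ... | no  _ | yes _ = refl
  ... | no  _ | no  _ = refl

  saving-refl : ∀ v → saving v v ≡ 2
  saving-refl v with v ≟ v
  ... | yes _   = refl
  ... | no  v≢v = contradiction refl v≢v

  saving-~ : ∀ {v w} → v ~ w → 1 ≤ saving v w
  saving-~ {v} {w} v~w with v ≟ w | v ~? w
  ... | yes _ | _       = s≤s z≤n
  ... | no  _ | yes _   = s≤s z≤n
  ... | no  _ | no  v≁w = contradiction v~w v≁w

-- Consequences of the degree bound: diameter at most two, and the matching.

module LargeDegrees {n : ℕ} (G : Graph n)
  (large : ∀ v → 2 ℕ.* n ℕ.≤ 3 ℕ.* (1 ℕ.+ degree G v)) where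
  open import Data.Nat.Base using (_+_; _*_; _∸_; _≤_; _<_; z≤n; s≤s)
  open Graph G
  open Sums
  open Neighbourhoods G
  open ℕₚ.≤-Reasoning

  -- Otherwise the two neighbourhoods and the pair `v`, `w` are disjoint, so `d_v + d_w + 2 ≤ n`.
  -- The degree bounds make three times the left side at least `4 n`, which is absurd as `n > 0`.
  common-neighbour : ∀ {v w} → ¬ v ≡ w → ¬ v ~ w → ∃ λ z → v ~ z × w ~ z
  common-neighbour {v} {w} v≢w v≁w with any? (both? v w)
  ... | yes found = found
  ... | no  none  = contradiction 4n≤3n (ℕₚ.<⇒≱ (ℕₚ.*-monoˡ-< n {{n>0 v}} (ℕₚ.n<1+n 3)))
    where
    n>0 : ∀ {m} → Fin m → ℕ.NonZero m
    n>0 zero    = _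
    n>0 (suc _) = _
    common≡0 : common v w ≡ 0
    common≡0 = trans (sum-cong-≗ λ z → 𝟙-no (both? v w z) λ p → none (z , p)) (sum-replicate-zero n)
    4n≤3n : 4 * n ≤ 3 * n
    4n≤3n = begin
      4 * n                                          ≡⟨ dbl n ⟩
      2 * n + 2 * n                                  ≤⟨ ℕₚ.+-mono-≤ (large v) (large w) ⟩
      3 * (1 + degree G v) + 3 * (1 + degree G w)    ≡⟨ lin (degree G v) (degree G w) ⟩
      3 * (degree G v + degree G w + 2)
        ≤⟨ ℕₚ.*-monoʳ-≤ 3 (nonadjacent-degree+degree≤ v≢w v≁w) ⟩
      3 * (n + common v w)   ≡⟨ cong (λ k → 3 * (n + k)) common≡0 ⟩
      3 * (n + 0)            ≡⟨ cong (3 *_) (ℕₚ.+-identityʳ n) ⟩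
      3 * n                  ∎
      where
      dbl : ∀ n → 4 * n ≡ 2 * n + 2 * n
      dbl = solve-∀
      lin : ∀ a b → 3 * (1 + a) + 3 * (1 + b) ≡ 3 * (a + b + 2)
      lin = solve-∀

  -- There is a walk of length `hops v w`, through a common neighbour where necessary. In particular
  -- no distance is infinite, so every coupling has finite cost.
  dist≤hops : ∀ v w → ∃ λ k → dist G v w ≡ [ k ] × k ≤ hops v w
  dist≤hops v w = bound (dist G v w) (dist-correct G v w) walk
    where
    bound : ∀ d → IsDistance G v w d → Walk G (hops v w) v w → ∃ λ k → d ≡ [ k ] × k ≤ hops v w
    bound [ k ] (_ , least) p = k , refl , least _ p
    bound ⊤⁺    none        p = contradiction p (none _)
    walk : Walk G (hops v w) v w
    walk with v ≟ w | v ~? w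
    ... | yes refl | _       = []
    ... | no  _    | yes v~w = v~w ∷ []
    ... | no  v≢w  | no  v≁w with common-neighbour v≢w v≁w
    ...   | _ , v~z , w~z = v~z ∷ (~-sym w~z ∷ [])

  n≤2d : ∀ v → n ≤ 2 * (1 + degree G v)
  n≤2d v = ℕₚ.*-cancelˡ-≤ 2 (begin
    2 * n                        ≤⟨ large v ⟩
    3 * (1 + degree G v)         ≤⟨ ℕₚ.*-monoˡ-≤ (1 + degree G v) (ℕₚ.n≤1+n 3) ⟩
    4 * (1 + degree G v)         ≡⟨ ℕₚ.*-assoc 2 2 (1 + degree G v) ⟩
    2 * (2 * (1 + degree G v))   ∎)

  module Edge {x y} (x~y : x ~ y) where
    open Flows {n}

    c a b : ℕ
    c = common x y
    a = only x y
    b = only y x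

    dx≡ : degree G x ≡ 1 + (c + a)
    dx≡ = degree-split x~y

    dy≡ : degree G y ≡ 1 + (c + b)
    dy≡ = trans (degree-split (~-sym x~y)) (cong (λ k → 1 + (k + b)) (common-comm y x))

    A B : Fin n → ℕ
    A v = 𝟙 (only? x y v)
    B v = 𝟙 (only? y x v)

    matching-bounds : ∀ m → m < b ∸ (c + 2) →
      m < a × m < b × (∀ u w → 0 < A u → 0 < B w → m < out _~?_ A B u + into _~?_ A B w)
    matching-bounds m m<b-c-2 = m<a , ℕₚ.<-≤-trans m<b-c-2 (ℕₚ.m∸n≤m b (c + 2)) , m<out+in
      where
      m+c+2<b : 1 + m + (c + 2) ≤ b
      m+c+2<b = ℕₚ.m≤o∸n⇒m+n≤o (1 + m)
        (ℕₚ.<⇒≤ (ℕₚ.m∸n≢0⇒n<m (ℕₚ.m<n⇒n≢0 m<b-c-2))) m<b-c-2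

      -- Inclusion-exclusion for the neighbourhoods of `x` and `y` gives `a + b + c + 2 ≤ n`, and
      -- the degree of `x` gives `n ≤ 2 (2 + c + a)`. Hence `b ≤ a + c + 2`, so `A` is large enough
      -- for the matching.
      m<a : m < a
      m<a = ℕₚ.+-cancelʳ-≤ (4 + 3 * c + a + b + n) (1 + m) a (begin
        1 + m + (4 + 3 * c + a + b + n)
          ≡⟨ expand m a b c n ⟩
        ((1 + (c + a)) + (1 + (c + b))) + n + (1 + m + (c + 2))
          ≡⟨ cong₂ (λ d e → d + e + n + (1 + m + (c + 2))) dx≡ dy≡ ⟨
        (degree G x + degree G y) + n + (1 + m + (c + 2))
          ≤⟨ ℕₚ.+-mono-≤ (ℕₚ.+-mono-≤ (degree+degree≤ x y) (n≤2d x)) m+c+2<b ⟩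
        (n + c) + 2 * (1 + degree G x) + b
          ≡⟨ cong (λ d → (n + c) + 2 * (1 + d) + b) dx≡ ⟩
        (n + c) + 2 * (1 + (1 + (c + a))) + b
          ≡⟨ collect a b c n ⟩
        a + (4 + 3 * c + a + b + n)  ∎)
        where
        expand : ∀ m a b c n → 1 + m + (4 + 3 * c + a + b + n)
                 ≡ ((1 + (c + a)) + (1 + (c + b))) + n + (1 + m + (c + 2))
        expand = solve-∀
        collect : ∀ a b c n → (n + c) + 2 * (1 + (1 + (c + a))) + b
                  ≡ a + (4 + 3 * c + a + b + n)
        collect = solve-∀

      -- By `only-neighbours`, `u` has at least `b + du + 2 - n` neighbours in `B`, and `w` at least
      -- `a + dw + 2 - n` in `A`. Inserting `b ≥ m + c + 3` and `a + c = dx - 1`, the sum exceeds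
      -- `m` because the three degree bounds add up to `dx + du + dw + 3 ≥ 2 n`.
      m<out+in : ∀ u w → 0 < A u → 0 < B w → m < out _~?_ A B u + into _~?_ A B w
      m<out+in u w 0<Au 0<Bw = ℕₚ.*-cancelˡ-≤ 3 (ℕₚ.+-cancelʳ-≤ (6 * n) _ _ (begin
        3 * (1 + m) + 6 * n
          ≡⟨ thrice m n ⟩
        3 * (1 + m) + (2 * n + 2 * n + 2 * n)
          ≤⟨ ℕₚ.+-monoʳ-≤ (3 * (1 + m)) (ℕₚ.+-mono-≤ (ℕₚ.+-mono-≤ (large x) (large u)) (large w)) ⟩
        3 * (1 + m) + (3 * (1 + degree G x) + 3 * (1 + du) + 3 * (1 + dw))
          ≡⟨ cong (λ d → 3 * (1 + m) + (3 * (1 + d) + 3 * (1 + du) + 3 * (1 + dw))) dx≡ ⟩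
        3 * (1 + m) + (3 * (1 + (1 + (c + a))) + 3 * (1 + du) + 3 * (1 + dw))
          -- The estimate has a surplus of 2, tripled here because everything is multiplied by 3.
          ≤⟨ ℕₚ.m≤m+n _ 6 ⟩
        3 * (1 + m) + (3 * (1 + (1 + (c + a))) + 3 * (1 + du) + 3 * (1 + dw)) + 6
          ≡⟨ regroup m a c du dw ⟩
        3 * ((1 + m + (c + 2)) + du + 2 + (a + dw + 2))
          ≤⟨ ℕₚ.*-monoʳ-≤ 3 (ℕₚ.+-monoˡ-≤ (a + dw + 2) (ℕₚ.+-monoˡ-≤ 2 (ℕₚ.+-monoˡ-≤ du m+c+2<b))) ⟩
        3 * ((b + du + 2) + (a + dw + 2))
          ≤⟨ ℕₚ.*-monoʳ-≤ 3 (ℕₚ.+-mono-≤ (only-neighbours (indicated (only? x y u) 0<Au))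
                                         (only-neighbours (indicated (only? y x w) 0<Bw))) ⟩
        3 * ((out _~?_ A B u + n) + (sum (λ i → A i * 𝟙 (w ~? i)) + n))
          ≡⟨ cong (λ k → 3 * ((out _~?_ A B u + n) + (k + n)))
                  (sum-cong-≗ λ i → cong (A i *_) (𝟙-~-sym w i)) ⟩
        3 * ((out _~?_ A B u + n) + (into _~?_ A B w + n))
          ≡⟨ collect (out _~?_ A B u) (into _~?_ A B w) n ⟩
        3 * (out _~?_ A B u + into _~?_ A B w) + 6 * n  ∎))
        where
        du dw : ℕ
        du = degree G u
        dw = degree G w
        thrice : ∀ m n → 3 * (1 + m) + 6 * n ≡ 3 * (1 + m) + (2 * n + 2 * n + 2 * n)
        thrice = solve-∀
        regroup : ∀ m a c d e →
          3 * (1 + m) + (3 * (1 + (1 + (c + a))) + 3 * (1 + d) + 3 * (1 + e)) + 6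
          ≡ 3 * ((1 + m + (c + 2)) + d + 2 + (a + e + 2))
        regroup = solve-∀
        collect : ∀ p q n → 3 * ((p + n) + (q + n)) ≡ 3 * (p + q) + 6 * n
        collect = solve-∀

    matching : Flow _~?_ A B (b ∸ (c + 2))
    matching = flow-of-value _~?_ A B (b ∸ (c + 2)) matching-bounds

-- Integral transport plans whose cost is at most the total mass.

module Transport {n : ℕ} (G : Graph n)
  (large : ∀ v → 2 ℕ.* n ℕ.≤ 3 ℕ.* (1 ℕ.+ degree G v)) where
  open import Data.Nat.Base using (_+_; _*_; _∸_; _≤_; _<_; z≤n; s≤s)
  open Graph G
  open Sums
  open Flows {n}
  open Neighbourhoods G
  open LargeDegrees G large

  -- μ_z^α in units of 1/N, with α = H/N and (1 - α)/d_z = h/N.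
  ν : ℕ → ℕ → Fin n → Fin n → ℕ
  ν H h z v = 𝟙 (z ≟ v) * H + 𝟙 (z ~? v) * h

  sum-ν : ∀ H h z → sum (ν H h z) ≡ H + degree G z * h
  sum-ν H h z = begin
    sum (ν H h z)
      ≡⟨ ∑-distrib-+ (λ v → 𝟙 (z ≟ v) * H) (λ v → 𝟙 (z ~? v) * h) ⟩
    sum (λ v → 𝟙 (z ≟ v) * H) + sum (λ v → 𝟙 (z ~? v) * h)
      ≡⟨ cong₂ _+_ (sum-𝟙* z (λ _ → H)) (sym (*-distribʳ-sum h (λ v → 𝟙 (z ~? v)))) ⟩
    H + sum (λ v → 𝟙 (z ~? v)) * h
      ≡⟨ cong (λ d → H + d * h) (degree≡sum z) ⟨
    H + degree G z * h  ∎
    where open ≡-Reasoning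

  record Plan (S T : Fin n → ℕ) (N : ℕ) : Set where
    field
      plan  : Matrix
      row≡  : ∀ i → row plan i ≡ S i
      col≡  : ∀ j → col plan j ≡ T j
      cost≤ : total (λ i j → hops i j * plan i j) ≤ N

  transpose : ∀ {S T N} → Plan S T N → Plan T S N
  transpose {N = N} P = record
    { plan  = λ i j → plan j i
    ; row≡  = col≡
    ; col≡  = row≡
    ; cost≤ = subst (_≤ N) (trans (∑-comm (λ i j → hops i j * plan i j))
        (sum-cong-≗ λ j → sum-cong-≗ λ i → cong (_* plan i j) (hops-sym i j))) cost≤
    }
    where open Plan P

  *-monoˡ-≤-support : ∀ {k s} m → (0 < m → k ≤ s) → k * m ≤ s * m
  *-monoˡ-≤-support {k} {s} zero    _   = ℕₚ.≤-reflexive (trans (ℕₚ.*-zeroʳ k) (sym (ℕₚ.*-zeroʳ s)))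
  *-monoˡ-≤-support         (suc m) k≤s = ℕₚ.*-monoˡ-≤ (suc m) (k≤s ℕ.z<s)

  -- Since `saving` and `hops` add up to 2, the cost of any completion is twice the mass minus its
  -- savings, and completing `θ` can only increase the savings.
  plan-from-partial : ∀ {S T θ} → sum S ≡ sum T → Fits S T θ →
    sum S ≤ total (λ i j → saving i j * θ i j) → Plan S T (sum S)
  plan-from-partial {S} {T} {θ} S≡T fits enough =
    let π , row≡ , col≡ , θ≤π = complete S≡T (sum S ∸ total θ) fits
                                  (ℕₚ.m+[n∸m]≡n (sum-mono (row≤ fits)))
        hopsπ = λ i j → hops i j * π i j
        savingπ = λ i j → saving i j * π i j
    in record
    { plan  = π
    ; row≡  = row≡
    ; col≡  = col≡
    ; cost≤ = ℕₚ.+-cancelʳ-≤ (sum S) _ _ (begin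
        total hopsπ + sum S            ≤⟨ ℕₚ.+-monoʳ-≤ (total hopsπ) enough ⟩
        total hopsπ + total (λ i j → saving i j * θ i j)
          ≤⟨ ℕₚ.+-monoʳ-≤ (total hopsπ) (total-mono λ i j → ℕₚ.*-monoʳ-≤ (saving i j) (θ≤π i j)) ⟩
        total hopsπ + total savingπ    ≡⟨ total-⊞ hopsπ savingπ ⟨
        total (hopsπ ⊞ savingπ)        ≡⟨ (sum-cong-≗ λ i → sum-cong-≗ λ j → both i j (π i j)) ⟩
        total (2 ⊙ π)                  ≡⟨ total-⊙ 2 π ⟩
        2 * total π                    ≡⟨ cong (2 *_) (sum-cong-≗ row≡) ⟩
        2 * sum S                      ≡⟨ cong (sum S +_) (ℕₚ.+-identityʳ (sum S)) ⟩
        sum S + sum S                  ∎)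
    }
    where
    open ℕₚ.≤-Reasoning
    both : ∀ i j p → hops i j * p + saving i j * p ≡ 2 * p
    both i j p = trans (sym (ℕₚ.*-distribʳ-+ p (hops i j) (saving i j)))
      (cong (_* p) (trans (ℕₚ.+-comm (hops i j) (saving i j)) (saving+hops i j)))

  module Ordered {x y} (x~y : x ~ y) (dx≤dy : degree G x ≤ degree G y) (k : ℕ) where
    open ℕₚ.≤-Reasoning

    open Edge x~y
    dx dy t H E : ℕ
    dx = degree G x
    dy = degree G y
    t = b ∸ (c + 2)
    H = suc k * (dx * dy)
    -- Of the demand `H` at `y`, `dy` is met by mass already there. The supply left at `x` is
    -- `H - dx`, which is no smaller than `E`.
    E = H ∸ dy

    F : Flow _~?_ A B t
    F = matching

    M : Matrix
    M = flow F

    E+dy≡H : E + dy ≡ H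
    E+dy≡H = ℕₚ.m∸n+n≡m (begin
      dy                  ≤⟨ ℕₚ.m≤n*m dy dx {{~⇒degree≢0 G x~y}} ⟩
      dx * dy             ≤⟨ ℕₚ.m≤m+n (dx * dy) (k * (dx * dy)) ⟩
      H                   ∎)

    -- The pointwise minimum of the two measures: `H` against `dx` at `x`, `dy` against `H` at `y`,
    -- `dy` against `dx` at a common neighbour, and 0 elsewhere.
    stay : Fin n → ℕ
    stay v = dx * 𝟙 (x ≟ v) + dy * 𝟙 (y ≟ v) + dx * 𝟙 (both? x y v)

    -- The three summands of θ save 2, 1 and 1 per unit of mass.
    bulk θ : Matrix
    bulk = E ⊙ unit x y
    θ = diagonal stay ⊞ bulk ⊞ dx ⊙ M

    row-θ : ∀ i → row θ i ≡ stay i + (E * 𝟙 (x ≟ i) + dx * row M i)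
    row-θ i = trans (row-⊞ (diagonal stay) (bulk ⊞ dx ⊙ M) i) (cong₂ _+_ (row-diagonal stay i)
      (trans (row-⊞ bulk (dx ⊙ M) i)
        (cong₂ _+_ (trans (row-⊙ E (unit x y) i) (cong (E *_) (row-unit x y i))) (row-⊙ dx M i))))

    col-θ : ∀ j → col θ j ≡ stay j + (E * 𝟙 (y ≟ j) + dx * col M j)
    col-θ j = trans (col-⊞ (diagonal stay) (bulk ⊞ dx ⊙ M) j) (cong₂ _+_ (col-diagonal stay j)
      (trans (col-⊞ bulk (dx ⊙ M) j)
        (cong₂ _+_ (trans (col-⊙ E (unit x y) j) (cong (E *_) (col-unit x y j))) (col-⊙ dx M j))))

    -- A row becomes exactly the supply once its coefficients `dx` are raised to `dy` and the
    -- matched degree to `A i`. A column needs only its matched degree raised to `B j`.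
    fits-θ : Fits (ν H dy x) (ν H dx y) θ
    fits-θ = record
      { row≤ = λ i → let X = 𝟙 (x ≟ i); Y = 𝟙 (y ≟ i); C = 𝟙 (both? x y i)in begin
          row θ i
            ≡⟨ row-θ i ⟩
          dx * X + dy * Y + dx * C + (E * X + dx * row M i)
            ≤⟨ ℕₚ.+-mono-≤
                 (ℕₚ.+-mono-≤ (ℕₚ.+-monoˡ-≤ (dy * Y) (ℕₚ.*-monoˡ-≤ X dx≤dy)) (ℕₚ.*-monoˡ-≤ C dx≤dy))
                 (ℕₚ.+-monoʳ-≤ (E * X) (ℕₚ.*-mono-≤ dx≤dy (row≤ (fits F) i))) ⟩
          dy * X + dy * Y + dy * C + (E * X + dy * A i)
            ≡⟨ collectʳ E dy X Y C (A i) ⟩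
          X * (E + dy) + (Y + (C + A i)) * dy
            ≡⟨ cong₂ (λ h m → X * h + m * dy) E+dy≡H (sym (neighbours-split x~y i)) ⟩
          ν H dy x i  ∎
      ; col≤ = λ j → let X = 𝟙 (x ≟ j); Y = 𝟙 (y ≟ j); C = 𝟙 (both? x y j)in begin
          col θ j
            ≡⟨ col-θ j ⟩
          dx * X + dy * Y + dx * C + (E * Y + dx * col M j)
            ≤⟨ ℕₚ.+-monoʳ-≤ (stay j) (ℕₚ.+-monoʳ-≤ (E * Y) (ℕₚ.*-monoʳ-≤ dx (col≤ (fits F) j))) ⟩
          dx * X + dy * Y + dx * C + (E * Y + dx * B j)
            ≡⟨ collectᶜ E dx dy X Y C (B j) ⟩
          Y * (E + dy) + (X + (C + B j)) * dx
            ≡⟨ cong (λ m → Y * (E + dy) + (X + (m + B j)) * dx) (both-comm x y j) ⟩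
          Y * (E + dy) + (X + (𝟙 (both? y x j) + B j)) * dx
            ≡⟨ cong₂ (λ h m → Y * h + m * dx) E+dy≡H (sym (neighbours-split (~-sym x~y) j)) ⟩
          ν H dx y j  ∎
      }
      where
      collectʳ : ∀ E d X Y C A → d * X + d * Y + d * C + (E * X + d * A)
                 ≡ X * (E + d) + (Y + (C + A)) * d
      collectʳ = solve-∀
      collectᶜ : ∀ E d e X Y C B → d * X + e * Y + d * C + (E * Y + d * B)
                 ≡ Y * (E + e) + (X + (C + B)) * d
      collectᶜ = solve-∀

    saved : Matrix
    saved = 2 ⊙ diagonal stay ⊞ 1 ⊙ bulk ⊞ 1 ⊙ (dx ⊙ M)

    -- Each weight has to be justified only on the support of its summand: the diagonal, the pair
    -- `x`, `y`, and the matching edges.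
    saved≤ : ∀ i j → saved i j ≤ saving i j * θ i j
    saved≤ i j = begin
      saved i j
        ≤⟨ ℕₚ.+-mono-≤ (*-monoˡ-≤-support (diagonal stay i j) on-diagonal)
             (ℕₚ.+-mono-≤ (*-monoˡ-≤-support (bulk i j) on-bulk)
                          (*-monoˡ-≤-support (dx * M i j) on-matching)) ⟩
      saving i j * diagonal stay i j + (saving i j * bulk i j + saving i j * (dx * M i j))
        ≡⟨ factor (saving i j) (diagonal stay i j) (bulk i j) (dx * M i j) ⟩
      saving i j * θ i j  ∎
      where
      factor : ∀ s p q r → s * p + (s * q + s * r) ≡ s * (p + (q + r))
      factor = solve-∀
      positive-factor : ∀ m {p} → 0 < m * p → 0 < p
      positive-factor m {zero}  0<0 = contradiction (subst (0 <_) (ℕₚ.*-zeroʳ m) 0<0) (ℕₚ.n≮n 0)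
      positive-factor m {suc _} _   = ℕ.z<s
      positive-𝟙* : ∀ {P : Set} (P? : Dec P) {p} → 0 < 𝟙 P? * p → P
      positive-𝟙* (yes q) _ = q
      on-diagonal : 0 < diagonal stay i j → 2 ≤ saving i j
      on-diagonal 0< with refl ← positive-𝟙* (i ≟ j) 0< = ℕₚ.≤-reflexive (sym (saving-refl i))
      on-bulk : 0 < bulk i j → 1 ≤ saving i j
      on-bulk 0<
        with refl ← positive-𝟙* (x ≟ i) (positive-factor E 0<)
           | refl ← indicated (y ≟ j) (positive-factor (𝟙 (x ≟ i)) (positive-factor E 0<)) = saving-~ x~y
      on-matching : 0 < dx * M i j → 1 ≤ saving i j
      on-matching 0< = saving-~ (along F i j (positive-factor dx 0<))

    total-stay : total (diagonal stay) ≡ dx + dy + dx * c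
    total-stay = begin-equality
      total (diagonal stay)   ≡⟨ sum-cong-≗ (row-diagonal stay) ⟩
      sum stay                ≡⟨ ∑-distrib-+ (λ v → dx * 𝟙 (x ≟ v) + dy * 𝟙 (y ≟ v)) (λ v → dx * 𝟙 (both? x y v)) ⟩
      sum (λ v → dx * 𝟙 (x ≟ v) + dy * 𝟙 (y ≟ v)) + sum (λ v → dx * 𝟙 (both? x y v))
        ≡⟨ cong₂ _+_ (∑-distrib-+ (λ v → dx * 𝟙 (x ≟ v)) (λ v → dy * 𝟙 (y ≟ v)))
                     (sym (*-distribˡ-sum dx (λ v → 𝟙 (both? x y v)))) ⟩
      sum (λ v → dx * 𝟙 (x ≟ v)) + sum (λ v → dy * 𝟙 (y ≟ v)) + dx * c
        ≡⟨ cong (_+ dx * c) (cong₂ _+_ (scaled dx x) (scaled dy y)) ⟩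
      dx + dy + dx * c  ∎
      where
      scaled : ∀ d v → sum (λ w → d * 𝟙 (v ≟ w)) ≡ d
      scaled d v = trans (sym (*-distribˡ-sum d (λ w → 𝟙 (v ≟ w))))
                         (trans (cong (d *_) (sum-𝟙 v)) (ℕₚ.*-identityʳ d))

    total-saved : total saved ≡ 2 * (dx + dy + dx * c) + (E + dx * t)
    total-saved = begin-equality
      total saved
        ≡⟨ total-⊞ (2 ⊙ diagonal stay) (1 ⊙ bulk ⊞ 1 ⊙ (dx ⊙ M)) ⟩
      total (2 ⊙ diagonal stay) + total (1 ⊙ bulk ⊞ 1 ⊙ (dx ⊙ M))
        ≡⟨ cong₂ _+_ (trans (total-⊙ 2 (diagonal stay)) (cong (2 *_) total-stay))
                     (total-⊞ (1 ⊙ bulk) (1 ⊙ (dx ⊙ M))) ⟩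
      2 * (dx + dy + dx * c) + (total (1 ⊙ bulk) + total (1 ⊙ (dx ⊙ M)))
        ≡⟨ cong₂ (λ p q → 2 * (dx + dy + dx * c) + (p + q))
                 (trans (total-⊙ 1 bulk) (trans (ℕₚ.*-identityˡ (total bulk))
                   (trans (total-⊙ E (unit x y)) (trans (cong (E *_) (total-unit x y)) (ℕₚ.*-identityʳ E)))))
                 (trans (total-⊙ 1 (dx ⊙ M)) (trans (ℕₚ.*-identityˡ (total (dx ⊙ M)))
                   (trans (total-⊙ dx M) (cong (dx *_) (total≡m F))))) ⟩
      2 * (dx + dy + dx * c) + (E + dx * t)  ∎

    mass≤saved : H + dx * dy ≤ total saved
    mass≤saved = begin
      H + dx * dy                              ≡⟨ cong (_+ dx * dy) E+dy≡H ⟨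
      E + dy + dx * dy                         ≤⟨ ℕₚ.+-monoʳ-≤ (E + dy) (ℕₚ.*-monoʳ-≤ dx dy≤) ⟩
      E + dy + dx * (1 + (c + (c + 2 + t)))    ≡⟨ expand E dx dy c t ⟩
      -- The only place in this budget where the order of the degrees is used: one remaining `dx` is
      -- covered by a `dy`.
      dx + (2 * dx + 2 * dx * c + dy + (E + dx * t)) ≤⟨ ℕₚ.+-monoˡ-≤ _ dx≤dy ⟩
      dy + (2 * dx + 2 * dx * c + dy + (E + dx * t)) ≡⟨ collect E dx dy c t ⟩
      2 * (dx + dy + dx * c) + (E + dx * t)    ≡⟨ total-saved ⟨
      total saved                              ∎
      where
      dy≤ : dy ≤ 1 + (c + (c + 2 + t))
      dy≤ = begin
        dy                        ≡⟨ dy≡ ⟩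
        -- The bound `b ≤ c + 2 + t` also holds when the subtraction in `t` truncates to 0, so a
        -- small `b` with an empty matching is covered as well.
        1 + (c + b)               ≤⟨ ℕₚ.+-monoʳ-≤ 1 (ℕₚ.+-monoʳ-≤ c (ℕₚ.m≤n+m∸n b (c + 2))) ⟩
        1 + (c + (c + 2 + t))     ∎
      expand : ∀ E d e c t → E + e + d * (1 + (c + (c + 2 + t)))
               ≡ d + (2 * d + 2 * d * c + e + (E + d * t))
      expand = solve-∀
      collect : ∀ E d e c t → e + (2 * d + 2 * d * c + e + (E + d * t))
                ≡ 2 * (d + e + d * c) + (E + d * t)
      collect = solve-∀

    ordered-plan : Plan (ν H dy x) (ν H dx y) (H + dx * dy)
    ordered-plan = subst (Plan (ν H dy x) (ν H dx y)) (sum-ν H dy x)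
      (plan-from-partial
        (trans (sum-ν H dy x) (trans (cong (H +_) (ℕₚ.*-comm dx dy)) (sym (sum-ν H dx y))))
        fits-θ
        (begin
          sum (ν H dy x)    ≡⟨ sum-ν H dy x ⟩
          H + dx * dy       ≤⟨ mass≤saved ⟩
          total saved       ≤⟨ total-mono saved≤ ⟩
          total (λ i j → saving i j * θ i j)  ∎))

  transport : ∀ {x y} → x ~ y → ∀ k → let D = degree G x * degree G y in
    Plan (ν (suc k * D) (degree G y) x) (ν (suc k * D) (degree G x) y) (suc k * D + D)
  transport {x} {y} x~y k with ℕₚ.≤-total (degree G x) (degree G y)
  ... | inj₁ dx≤dy = Ordered.ordered-plan x~y dx≤dy k
  -- The distance is symmetric, so reversing a plan from `y` to `x` keeps its cost.
  ... | inj₂ dy≤dx = transpose (subst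
    (λ D → Plan (ν (suc k * D) (degree G x) y) (ν (suc k * D) (degree G y) x) (suc k * D + D))
    (ℕₚ.*-comm (degree G y) (degree G x)) (Ordered.ordered-plan (~-sym x~y) dy≤dx k))

open import Data.Integer.Base as ℤ using (+_)
import Data.Integer.Properties as ℤₚ
import Data.Integer.Tactic.RingSolver as ℤ-Solver
open import Data.Rational.Base as ℚ using (ℚ; 0ℚ; 1ℚ; ½; ∣_∣; mkℚ; toℚᵘ)
import Data.Rational.Properties as ℚₚ
open import Data.Rational.Solver using (module +-*-Solver)
open import Data.Rational.Unnormalised.Base as ℚᵘ using (mkℚᵘ; *≤*; *<*; *≡*)
import Data.Rational.Unnormalised.Properties as ℚᵘₚ
open import Defs

-- Fractions of natural numbers.

module Fractions where
  infixl 8 _⁄_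
  _⁄_ : ℕ → (n : ℕ) → .{{ℕ.NonZero n}} → ℚ
  a ⁄ n = + a ℚ./ n

  -- Passing to unnormalised fractions replaces the gcd reduction inside `a ⁄ n` by
  -- cross-multiplication.
  toℚᵘ-⁄ : ∀ a n → toℚᵘ (a ⁄ suc n) ℚᵘ.≃ mkℚᵘ (+ a) n
  toℚᵘ-⁄ a n = ℚₚ.toℚᵘ-fromℚᵘ (mkℚᵘ (+ a) n)

  ⁄-cong : ∀ a b m n .{{_ : ℕ.NonZero m}} .{{_ : ℕ.NonZero n}} → a ℕ.* n ≡ b ℕ.* m → a ⁄ m ≡ b ⁄ n
  ⁄-cong a b (suc m) (suc n) eq = ℚₚ.fromℚᵘ-cong {mkℚᵘ (+ a) m} {mkℚᵘ (+ b) n}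
    (*≡* (trans (sym (ℤₚ.pos-* a (suc n))) (trans (cong +_ eq) (ℤₚ.pos-* b (suc m)))))

  ⁄-mono-≤ : ∀ a b m n .{{_ : ℕ.NonZero m}} .{{_ : ℕ.NonZero n}} → a ℕ.* n ℕ.≤ b ℕ.* m → a ⁄ m ℚ.≤ b ⁄ n
  ⁄-mono-≤ a b (suc m) (suc n) le = ℚₚ.toℚᵘ-cancel-≤ (begin
    toℚᵘ (a ⁄ suc m)  ≃⟨ toℚᵘ-⁄ a m ⟩
    mkℚᵘ (+ a) m      ≤⟨ *≤* (subst₂ ℤ._≤_ (ℤₚ.pos-* a (suc n)) (ℤₚ.pos-* b (suc m)) (ℤ.+≤+ le)) ⟩
    mkℚᵘ (+ b) n      ≃⟨ toℚᵘ-⁄ b n ⟨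
    toℚᵘ (b ⁄ suc n)  ∎)
    where open ℚᵘₚ.≤-Reasoning

  ⁄-cancel-≤ : ∀ a b m n .{{_ : ℕ.NonZero m}} .{{_ : ℕ.NonZero n}} → a ⁄ m ℚ.≤ b ⁄ n → a ℕ.* n ℕ.≤ b ℕ.* m
  ⁄-cancel-≤ a b (suc m) (suc n) le = ℤₚ.drop‿+≤+
    (subst₂ ℤ._≤_ (sym (ℤₚ.pos-* a (suc n))) (sym (ℤₚ.pos-* b (suc m))) (ℚᵘₚ.drop-*≤* (begin
      mkℚᵘ (+ a) m      ≃⟨ toℚᵘ-⁄ a m ⟨
      toℚᵘ (a ⁄ suc m)  ≤⟨ ℚₚ.toℚᵘ-mono-≤ le ⟩
      toℚᵘ (b ⁄ suc n)  ≃⟨ toℚᵘ-⁄ b n ⟩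
      mkℚᵘ (+ b) n      ∎)))
    where open ℚᵘₚ.≤-Reasoning

  ⁄-+ : ∀ a b n .{{_ : ℕ.NonZero n}} → a ⁄ n ℚ.+ b ⁄ n ≡ (a ℕ.+ b) ⁄ n
  ⁄-+ a b (suc n) = ℚₚ.toℚᵘ-injective (begin-equality
    toℚᵘ (a ⁄ suc n ℚ.+ b ⁄ suc n)           ≃⟨ ℚₚ.toℚᵘ-homo-+ (a ⁄ suc n) (b ⁄ suc n) ⟩
    toℚᵘ (a ⁄ suc n) ℚᵘ.+ toℚᵘ (b ⁄ suc n)   ≃⟨ ℚᵘₚ.+-cong (toℚᵘ-⁄ a n) (toℚᵘ-⁄ b n) ⟩
    mkℚᵘ (+ a) n ℚᵘ.+ mkℚᵘ (+ b) n           ≃⟨ *≡* (common-denominator (+ a) (+ b) (+ suc n)) ⟩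
    mkℚᵘ (+ (a ℕ.+ b)) n                     ≃⟨ toℚᵘ-⁄ (a ℕ.+ b) n ⟨
    toℚᵘ ((a ℕ.+ b) ⁄ suc n)                 ∎)
    where
    open ℚᵘₚ.≤-Reasoning
    common-denominator : ∀ a b n → (a ℤ.* n ℤ.+ b ℤ.* n) ℤ.* n ≡ (a ℤ.+ b) ℤ.* (n ℤ.* n)
    common-denominator = ℤ-Solver.solve-∀

  ⁄-* : ∀ a b m n .{{_ : ℕ.NonZero m}} .{{_ : ℕ.NonZero n}} →
        a ⁄ m ℚ.* b ⁄ n ≡ _⁄_ (a ℕ.* b) (m ℕ.* n) {{ℕₚ.m*n≢0 m n}}
  ⁄-* a b (suc m) (suc n) = ℚₚ.toℚᵘ-injective (begin-equality
    toℚᵘ (a ⁄ suc m ℚ.* b ⁄ suc n)           ≃⟨ ℚₚ.toℚᵘ-homo-* (a ⁄ suc m) (b ⁄ suc n) ⟩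
    toℚᵘ (a ⁄ suc m) ℚᵘ.* toℚᵘ (b ⁄ suc n)   ≃⟨ ℚᵘₚ.*-cong (toℚᵘ-⁄ a m) (toℚᵘ-⁄ b n) ⟩
    mkℚᵘ (+ a) m ℚᵘ.* mkℚᵘ (+ b) n           ≡⟨ cong (λ k → mkℚᵘ k (n ℕ.+ m ℕ.* suc n)) (sym (ℤₚ.pos-* a b)) ⟩
    mkℚᵘ (+ (a ℕ.* b)) (n ℕ.+ m ℕ.* suc n)   ≃⟨ toℚᵘ-⁄ (a ℕ.* b) (n ℕ.+ m ℕ.* suc n) ⟨
    toℚᵘ ((a ℕ.* b) ⁄ (suc m ℕ.* suc n))     ∎)
    where open ℚᵘₚ.≤-Reasoning

  n⁄n≡1 : ∀ n .{{_ : ℕ.NonZero n}} → n ⁄ n ≡ 1ℚ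
  n⁄n≡1 n = ⁄-cong n 1 n 1 (ℕₚ.*-comm n 1)

  0⁄n≡0 : ∀ n .{{_ : ℕ.NonZero n}} → 0 ⁄ n ≡ 0ℚ
  0⁄n≡0 n = ⁄-cong 0 0 n 1 refl

  0<1⁄n : ∀ n .{{_ : ℕ.NonZero n}} → 0ℚ ℚ.< 1 ⁄ n
  0<1⁄n (suc n) = ℚₚ.toℚᵘ-cancel-< (begin-strict
    mkℚᵘ (+ 0) 0      <⟨ *<* (ℤ.+<+ (ℕ.s≤s ℕ.z≤n)) ⟩
    mkℚᵘ (+ 1) n      ≃⟨ toℚᵘ-⁄ 1 n ⟨
    toℚᵘ (1 ⁄ suc n)  ∎)
    where open ℚᵘₚ.≤-Reasoning

  -- A positive fraction with denominator `1 + d` is at least one over it, hence exceeds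
  -- `1 ⁄ (2 + d)`.
  archimedean : ∀ {g} → 0ℚ ℚ.< g → ∃ λ k → 1 ⁄ (2 ℕ.+ k) ℚ.< g
  archimedean {g} 0<g = from-positive g (ℚ.positive 0<g)
    where
    from-positive : ∀ g → ℚ.Positive g → ∃ λ k → 1 ⁄ (2 ℕ.+ k) ℚ.< g
    from-positive (mkℚ ℤ.+[1+ p ] d _) _ = d , ℚₚ.toℚᵘ-cancel-< (begin-strict
      toℚᵘ (1 ⁄ (2 ℕ.+ d))      ≃⟨ toℚᵘ-⁄ 1 (suc d) ⟩
      mkℚᵘ (+ 1) (suc d)        <⟨ *<* (ℤ.+<+ (ℕ.s≤s (ℕₚ.≤-trans (ℕₚ.≤-reflexive (ℕₚ.+-identityʳ (suc d)))
                                     (ℕₚ.m≤m+n (suc d) (p ℕ.* (2 ℕ.+ d)))))) ⟩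
      mkℚᵘ ℤ.+[1+ p ] d         ∎)
      where open ℚᵘₚ.≤-Reasoning

open Fractions

-- Termwise comparison of reals, the degree hypothesis, and the values of `α`.

≗⇒≈ : ∀ {x y} → (∀ i → seq x i ≡ seq y i) → x ≈ y
≗⇒≈ {x} {y} eq = mk≈ λ ε 0<ε → 0 , λ i _ → subst (ℚ._< ε)
  (sym (trans (cong (λ q → ∣ q ℚ.- seq y i ∣) (eq i)) (cong ∣_∣ (ℚₚ.+-inverseʳ (seq y i))))) 0<ε

pointwise-≤ : ∀ {x y} → (∀ i → seq x i ℚ.≤ seq y i) → x ≤ y
pointwise-≤ {x} {y} le = mk≤ λ ε 0<ε → 0 , λ i _ → ℚₚ.≤-trans (le i)
  (subst (ℚ._≤ seq y i ℚ.+ ε) (ℚₚ.+-identityʳ (seq y i)) (ℚₚ.+-monoʳ-≤ (seq y i) (ℚₚ.<⇒≤ 0<ε)))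

seq-∑ : ∀ {m} N .{{_ : ℕ.NonZero N}} i {f : Fin m → ℝ} (a : Fin m → ℕ) →
        (∀ j → seq (f j) i ≡ a j ⁄ N) → seq (∑ f) i ≡ sum a ⁄ N
seq-∑ {zero}  N i a eq = sym (0⁄n≡0 N)
seq-∑ {suc m} N i a eq = trans (cong₂ ℚ._+_ (eq zero) (seq-∑ N i (a ∘ suc) (eq ∘ suc)))
                               (⁄-+ (a zero) (sum (a ∘ suc)) N)

minDegree≤ : ∀ {n} .{{_ : ℕ.NonZero n}} (G : Graph n) v → minDegree G ℕ.≤ degree G v
minDegree≤ {suc n} G v = min≤v⁺ (degree G zero) (map (degree G) (allFin (suc n)))
  (inj₂ (Any.map (ℕₚ.≤-reflexive ∘ sym) (∈-map⁺ (degree G) (∈-allFin v))))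

degrees-large : ∀ n .{{_ : ℕ.NonZero n}} (G : Graph n) →
  (+ minDegree G) ℚ./ 1 ℚ.≥ (+ (2 ℕ.* n)) ℚ./ 3 ℚ.- 1ℚ →
  ∀ v → 2 ℕ.* n ℕ.≤ 3 ℕ.* (1 ℕ.+ degree G v)
degrees-large n G hyp v = begin
  2 ℕ.* n                        ≡⟨ ℕₚ.*-identityʳ (2 ℕ.* n) ⟨
  2 ℕ.* n ℕ.* 1                  ≤⟨ ⁄-cancel-≤ (2 ℕ.* n) (minDegree G ℕ.+ 1) 3 1 in-ℚ ⟩
  (minDegree G ℕ.+ 1) ℕ.* 3      ≡⟨ flip (minDegree G) ⟩
  3 ℕ.* (1 ℕ.+ minDegree G)      ≤⟨ ℕₚ.*-monoʳ-≤ 3 (ℕₚ.+-monoʳ-≤ 1 (minDegree≤ G v)) ⟩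
  3 ℕ.* (1 ℕ.+ degree G v)       ∎
  where
  open ℕₚ.≤-Reasoning
  flip : ∀ m → (m ℕ.+ 1) ℕ.* 3 ≡ 3 ℕ.* (1 ℕ.+ m)
  flip = solve-∀
  cancel : ∀ q → q ≡ (q ℚ.- 1ℚ) ℚ.+ 1ℚ
  cancel = solve 1 (λ q → q := (q :- con 1ℚ) :+ con 1ℚ) refl
    where open +-*-Solver
  in-ℚ : (2 ℕ.* n) ⁄ 3 ℚ.≤ (minDegree G ℕ.+ 1) ⁄ 1
  in-ℚ = ℚₚ.≤-trans (ℚₚ.≤-reflexive (cancel ((2 ℕ.* n) ⁄ 3)))
    (ℚₚ.≤-trans (ℚₚ.+-monoˡ-≤ 1ℚ hyp) (ℚₚ.≤-reflexive (⁄-+ (minDegree G) 1 1)))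

-- The value `1 - 1/K` with `K = 2 + k`. Starting at `K = 2` makes the central mass `suc k * D` at
-- least `D`, hence at least either degree, so subtracting a degree from it never truncates.
laziness : ℕ → ℚ
laziness k = suc k ⁄ (2 ℕ.+ k)

laziness+1⁄ : ∀ k → laziness k ℚ.+ 1 ⁄ (2 ℕ.+ k) ≡ 1ℚ
laziness+1⁄ k = trans (⁄-+ (suc k) 1 (2 ℕ.+ k))
  (trans (cong (λ m → _⁄_ m (2 ℕ.+ k)) (ℕₚ.+-comm (suc k) 1)) (n⁄n≡1 (2 ℕ.+ k)))

1-laziness : ∀ k → 1ℚ ℚ.- laziness k ≡ 1 ⁄ (2 ℕ.+ k)
1-laziness k = trans (cong (ℚ._- laziness k) (sym (laziness+1⁄ k))) (cancel (laziness k) (1 ⁄ (2 ℕ.+ k)))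
  where
  open +-*-Solver
  cancel : ∀ p q → (p ℚ.+ q) ℚ.- p ≡ q
  cancel = solve 2 (λ p q → (p :+ q) :- p := q) refl

-- The bound 1 on the Wasserstein distance.

module Wasserstein {n : ℕ} (G : Graph n)
  (large : ∀ v → 2 ℕ.* n ℕ.≤ 3 ℕ.* (1 ℕ.+ degree G v)) where
  open Graph G
  open Sums
  open Neighbourhoods G
  open LargeDegrees G large
  open Flows {n}
  open Transport G large

  seq-μ-⁄ : ∀ {α x H h N i} v .{{_ : ℕ.NonZero (degree G x)}} .{{_ : ℕ.NonZero N}} →
    seq α i ≡ H ⁄ N → seq ((1ℝ - α) * fromℚ (1 ⁄ degree G x)) i ≡ h ⁄ N →
    seq (μ G α x v) i ≡ ν H h x v ⁄ N
  seq-μ-⁄ {x = x} {H} {h} {N} v centre neighbour with v ≟ x | x ≟ v | x ~? v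
  ... | yes refl | no  x≢x  | _       = contradiction refl x≢x
  ... | no  v≢v  | yes refl | _       = contradiction refl v≢v
  ... | yes _    | yes refl | yes x~x = contradiction x~x ~-irrefl
  ... | yes _    | yes _    | no _    = trans centre (cong (_⁄ N) (sym (simplify H)))
    where
    simplify : ∀ H → 1 ℕ.* H ℕ.+ 0 ≡ H
    simplify = solve-∀
  ... | no _     | no _     | yes _   = trans neighbour (cong (_⁄ N) (sym (ℕₚ.*-identityˡ h)))
  ... | no _     | no _     | no _    = sym (0⁄n≡0 N)

  -- Here `d` stands for the degree of the other endpoint. The denominator is `(2 + k) dx d`, so `α`
  -- has numerator `suc k * D` and the mass `(1 - α)/dx` of a neighbour has numerator `d`.
  seq-μ : ∀ k x v d .{{_ : ℕ.NonZero d}} .{{_ : ℕ.NonZero (degree G x)}} →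
    let D = degree G x ℕ.* d in .{{_ : ℕ.NonZero (suc k ℕ.* D ℕ.+ D)}} →
    ∀ i → seq (μ G (fromℚ (laziness k)) x v) i ≡ ν (suc k ℕ.* D) d x v ⁄ (suc k ℕ.* D ℕ.+ D)
  seq-μ k x v d i = seq-μ-⁄ {x = x} v
    (⁄-cong (suc k) (suc k ℕ.* D) (2 ℕ.+ k) N (centre k D))
    (begin
      (1ℚ ℚ.- laziness k) ℚ.* 1 ⁄ dx        ≡⟨ cong (ℚ._* 1 ⁄ dx) (1-laziness k) ⟩
      1 ⁄ (2 ℕ.+ k) ℚ.* 1 ⁄ dx              ≡⟨ ⁄-* 1 1 (2 ℕ.+ k) dx ⟩
      _⁄_ 1 ((2 ℕ.+ k) ℕ.* dx) {{ℕₚ.m*n≢0 (2 ℕ.+ k) dx}}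
        ≡⟨ ⁄-cong 1 d ((2 ℕ.+ k) ℕ.* dx) N {{ℕₚ.m*n≢0 (2 ℕ.+ k) dx}} (neighbour k dx d) ⟩
      d ⁄ N                                 ∎)
    where
    open ≡-Reasoning
    dx = degree G x
    D = dx ℕ.* d
    N = suc k ℕ.* D ℕ.+ D
    centre : ∀ k D → suc k ℕ.* (suc k ℕ.* D ℕ.+ D) ≡ suc k ℕ.* D ℕ.* (2 ℕ.+ k)
    centre = solve-∀
    neighbour : ∀ k e d → 1 ℕ.* (suc k ℕ.* (e ℕ.* d) ℕ.+ e ℕ.* d) ≡ d ℕ.* ((2 ℕ.+ k) ℕ.* e)
    neighbour = solve-∀

  module _ {x y} (x~y : x ~ y) (k : ℕ) where
    private
      instance
        dx≢0 : ℕ.NonZero (degree G x)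
        dx≢0 = ~⇒degree≢0 G x~y
        dy≢0 : ℕ.NonZero (degree G y)
        dy≢0 = ~⇒degree≢0 G (~-sym x~y)

      α = fromℚ (laziness k)
      D = degree G x ℕ.* degree G y
      N = suc k ℕ.* D ℕ.+ D

      instance
        N≢0 : ℕ.NonZero N
        N≢0 = ℕ.>-nonZero (ℕₚ.<-≤-trans (ℕ.>-nonZero⁻¹ D {{ℕₚ.m*n≢0 (degree G x) (degree G y)}})
                                        (ℕₚ.m≤n+m D (suc k ℕ.* D)))

      open Plan (transport x~y k)

      π : Fin n → Fin n → ℝ
      π v w = fromℚ (plan v w ⁄ N)

      row≡μ : ∀ v i → seq (μ G α x v) i ≡ row plan v ⁄ N
      row≡μ v i = trans (seq-μ k x v (degree G y) i) (cong (_⁄ N) (sym (row≡ v)))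

      col≡μ : ∀ w i → seq (μ G α y w) i ≡ col plan w ⁄ N
      col≡μ w i = trans (reindexed (ℕₚ.*-comm (degree G y) (degree G x)))
                        (cong (_⁄ N) (sym (col≡ w)))
        where
        -- From the side of `y` the product of degrees appears in the other order. Generalising it
        -- to `D′` transports the denominator together with its nonzero instance.
        reindexed : ∀ {D′} → degree G y ℕ.* degree G x ≡ D′ → .{{_ : ℕ.NonZero (suc k ℕ.* D′ ℕ.+ D′)}} →
          seq (μ G α y w) i ≡ ν (suc k ℕ.* D′) (degree G x) y w ⁄ (suc k ℕ.* D′ ℕ.+ D′)
        reindexed refl = seq-μ k y w (degree G x) i

      plan≤N : ∀ v w → plan v w ℕ.≤ N
      plan≤N v w = begin
        plan v w            ≤⟨ term≤sum (plan v) w ⟩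
        row plan v          ≤⟨ term≤sum (row plan) v ⟩
        total plan          ≡⟨ sum-cong-≗ row≡ ⟩
        sum (ν (suc k ℕ.* D) (degree G y) x)  ≡⟨ sum-ν (suc k ℕ.* D) (degree G y) x ⟩
        N                   ∎
        where open ℕₚ.≤-Reasoning

      coupling : IsCoupling G (μ G α x) (μ G α y) π
      coupling = record
        { lower     = λ v w → pointwise-≤ λ _ →
            subst (ℚ._≤ plan v w ⁄ N) (0⁄n≡0 N) (⁄-mono-≤ 0 (plan v w) N N ℕ.z≤n)
        ; upper     = λ v w → pointwise-≤ λ _ →
            subst (plan v w ⁄ N ℚ.≤_) (n⁄n≡1 N) (⁄-mono-≤ (plan v w) N N N (ℕₚ.*-monoˡ-≤ N (plan≤N v w)))
        ; marginal₁ = λ v → ≗⇒≈ λ i → trans (seq-∑ N i (plan v) λ _ → refl) (sym (row≡μ v i))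
        ; marginal₂ = λ w → ≗⇒≈ λ i → trans (seq-∑ N i (λ v → plan v w) λ _ → refl) (sym (col≡μ w i))
        }

      steps : Fin n → Fin n → ℕ
      steps v w = proj₁ (dist≤hops v w)

      dist≡steps : ∀ v w → dist G v w ≡ [ steps v w ]
      dist≡steps v w = proj₁ (proj₂ (dist≤hops v w))

      cost : ℝ
      cost = ∑ λ v → ∑ λ w → _·_ G (dist G v w) (π v w)

      has-cost : HasCost G π cost
      has-cost = (λ v w dist≡⊤ → contradiction (trans (sym (dist≡steps v w)) dist≡⊤) λ ()) ,
                 ≗⇒≈ λ _ → refl

      seq-cost : ∀ i → seq cost i ≡ total (λ v w → steps v w ℕ.* plan v w) ⁄ N
      seq-cost i = seq-∑ N i (row (λ v w → steps v w ℕ.* plan v w)) λ v →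
                   seq-∑ N i (λ w → steps v w ℕ.* plan v w) λ w → begin
        seq (_·_ G (dist G v w) (π v w)) i       ≡⟨ cong (λ d → seq (_·_ G d (π v w)) i) (dist≡steps v w) ⟩
        steps v w ⁄ 1 ℚ.* plan v w ⁄ N           ≡⟨ ⁄-* (steps v w) (plan v w) 1 N ⟩
        _⁄_ (steps v w ℕ.* plan v w) (1 ℕ.* N) {{ℕₚ.m*n≢0 1 N}}
          ≡⟨ ⁄-cong (steps v w ℕ.* plan v w) (steps v w ℕ.* plan v w) (1 ℕ.* N) N {{ℕₚ.m*n≢0 1 N}}
               (cong ((steps v w ℕ.* plan v w) ℕ.*_) (sym (ℕₚ.*-identityˡ N))) ⟩
        (steps v w ℕ.* plan v w) ⁄ N             ∎
        where open ≡-Reasoning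

      seq-cost≤1 : ∀ i → seq cost i ℚ.≤ 1ℚ
      seq-cost≤1 i = begin
        seq cost i                                        ≡⟨ seq-cost i ⟩
        total (λ v w → steps v w ℕ.* plan v w) ⁄ N
          ≤⟨ ⁄-mono-≤ (total (λ v w → steps v w ℕ.* plan v w)) N N N (ℕₚ.*-monoˡ-≤ N (ℕₚ.≤-trans
               (total-mono λ v w → ℕₚ.*-monoˡ-≤ (plan v w) (proj₂ (proj₂ (dist≤hops v w)))) cost≤)) ⟩
        N ⁄ N                                             ≡⟨ n⁄n≡1 N ⟩
        1ℚ                                                ∎
        where open ℚₚ.≤-Reasoning

    -- The infimum is at most the cost of the coupling obtained from the integral plan, which is at
    -- most `N` units of size `1/N`.
    W₁≤1 : ∀ {w} → IsW₁ G (μ G α x) (μ G α y) w → w ≤ 1ℝ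
    W₁≤1 (lower-bound , _) = mk≤ λ ε 0<ε →
      let M , w≤cost = _≤_.eventually-≤ (lower-bound cost (π , coupling , has-cost)) ε 0<ε
      in M , λ i M≤i → ℚₚ.≤-trans (w≤cost i M≤i) (ℚₚ.+-monoˡ-≤ ε (seq-cost≤1 i))

-- Passage to the limit.

open +-*-Solver

p≤∣p∣ : ∀ p → p ℚ.≤ ∣ p ∣
p≤∣p∣ p with ℚₚ.∣p∣≡p∨∣p∣≡-p p | ℚₚ.≤-total 0ℚ p
... | inj₁ ∣p∣≡p | _        = ℚₚ.≤-reflexive (sym ∣p∣≡p)
... | inj₂ _     | inj₁ 0≤p = ℚₚ.≤-reflexive (sym (ℚₚ.0≤p⇒∣p∣≡p 0≤p))
... | inj₂ _     | inj₂ p≤0 = ℚₚ.≤-trans p≤0 (ℚₚ.0≤∣p∣ p)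

-p≤∣p∣ : ∀ p → ℚ.- p ℚ.≤ ∣ p ∣
-p≤∣p∣ p = subst (ℚ.- p ℚ.≤_) (ℚₚ.∣-p∣≡∣p∣ p) (p≤∣p∣ (ℚ.- p))

*-pos : ∀ {p q} → 0ℚ ℚ.< p → 0ℚ ℚ.< q → 0ℚ ℚ.< p ℚ.* q
*-pos {p} {q} 0<p 0<q = subst (ℚ._< p ℚ.* q) (ℚₚ.*-zeroʳ p)
  (ℚₚ.*-monoʳ-<-pos p {{ℚ.positive 0<p}} 0<q)

halves : ∀ q → ½ ℚ.* q ℚ.+ ½ ℚ.* q ≡ q
halves = solve 1 (λ q → con ½ :* q :+ con ½ :* q := q) refl

-- K is a term of κ_α, and r = 1/s that of 1/(1 - α).
curvature-bound : ∀ {K w κ g e s r} → 0ℚ ℚ.≤ r → s ℚ.* r ≡ 1ℚ → 0ℚ ℚ.≤ g →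
  ∣ K ℚ.- (1ℚ ℚ.- w) ∣ ℚ.≤ ½ ℚ.* (e ℚ.* s) → w ℚ.≤ 1ℚ ℚ.+ ½ ℚ.* (e ℚ.* s) →
  K ℚ.* r ℚ.+ g ℚ.≤ κ ℚ.+ e → 0ℚ ℚ.≤ κ ℚ.+ (e ℚ.+ e)
curvature-bound {K} {w} {κ} {g} {e} {s} {r} 0≤r sr≡1 0≤g close w≤ quotient≤ = begin
  0ℚ                                              ≡⟨ cancel K r ⟩
  ℚ.- K ℚ.* r ℚ.+ K ℚ.* r                         ≤⟨ ℚₚ.+-mono-≤ lower upper ⟩
  e ℚ.+ (κ ℚ.+ e)                                 ≡⟨ rearrange e κ ⟩
  κ ℚ.+ (e ℚ.+ e)                                 ∎
  where
  open ℚₚ.≤-Reasoning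
  η = ½ ℚ.* (e ℚ.* s)
  cancel : ∀ K r → 0ℚ ≡ ℚ.- K ℚ.* r ℚ.+ K ℚ.* r
  cancel = solve 2 (λ K r → con 0ℚ := (:- K) :* r :+ K :* r) refl
  rearrange : ∀ e κ → e ℚ.+ (κ ℚ.+ e) ≡ κ ℚ.+ (e ℚ.+ e)
  rearrange = solve 2 (λ e κ → e :+ (κ :+ e) := κ :+ (e :+ e)) refl
  split : ∀ K w → ℚ.- K ≡ ℚ.- (K ℚ.- (1ℚ ℚ.- w)) ℚ.+ (w ℚ.- 1ℚ)
  split = solve 2 (λ K w → :- K := :- (K :- (con 1ℚ :- w)) :+ (w :- con 1ℚ)) refl
  excess : ∀ η → (1ℚ ℚ.+ η) ℚ.- 1ℚ ≡ η
  excess = solve 1 (λ η → (con 1ℚ :+ η) :- con 1ℚ := η) refl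
  -- The error in `K ≈ 1 - w` and the slack in `w ≤ 1` are half of `e * s` each; dividing by `s`
  -- leaves `e`.
  -K≤es : ℚ.- K ℚ.≤ e ℚ.* s
  -K≤es = begin
    ℚ.- K                                           ≡⟨ split K w ⟩
    ℚ.- (K ℚ.- (1ℚ ℚ.- w)) ℚ.+ (w ℚ.- 1ℚ)
      ≤⟨ ℚₚ.+-mono-≤ (ℚₚ.≤-trans (-p≤∣p∣ (K ℚ.- (1ℚ ℚ.- w))) close) (ℚₚ.+-monoˡ-≤ (ℚ.- 1ℚ) w≤) ⟩
    η ℚ.+ ((1ℚ ℚ.+ η) ℚ.- 1ℚ)                       ≡⟨ cong (η ℚ.+_) (excess η) ⟩
    η ℚ.+ η                                         ≡⟨ halves (e ℚ.* s) ⟩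
    e ℚ.* s                                         ∎
  lower : ℚ.- K ℚ.* r ℚ.≤ e
  lower = begin
    ℚ.- K ℚ.* r         ≤⟨ ℚₚ.*-monoʳ-≤-nonNeg r {{ℚ.nonNegative 0≤r}} -K≤es ⟩
    e ℚ.* s ℚ.* r       ≡⟨ ℚₚ.*-assoc e s r ⟩
    e ℚ.* (s ℚ.* r)     ≡⟨ cong (e ℚ.*_) sr≡1 ⟩
    e ℚ.* 1ℚ            ≡⟨ ℚₚ.*-identityʳ e ⟩
    e                   ∎
  upper : K ℚ.* r ℚ.≤ κ ℚ.+ e
  upper = begin
    K ℚ.* r             ≡⟨ ℚₚ.+-identityʳ (K ℚ.* r) ⟨
    K ℚ.* r ℚ.+ 0ℚ      ≤⟨ ℚₚ.+-monoʳ-≤ (K ℚ.* r) 0≤g ⟩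
    K ℚ.* r ℚ.+ g       ≤⟨ quotient≤ ⟩
    κ ℚ.+ e             ∎

-- From some index on, `δ` is at least a rational `g > 0`. Choosing `1/K < g` leaves the gap
-- `g - 1/K`.
laziness-near-1 : ∀ {δ} → 0ℝ < δ → ∃ λ k → 1ℝ - δ < fromℚ (laziness k)
laziness-near-1 {δ} (mk< g 0<g M g≤δ) =
  let k , 1/K<g = archimedean 0<g
      1/K = 1 ⁄ (2 ℕ.+ k)
  in k , mk< (g ℚ.- 1/K)
    (subst (ℚ._< g ℚ.- 1/K) (ℚₚ.+-inverseʳ 1/K) (ℚₚ.+-monoˡ-< (ℚ.- 1/K) 1/K<g)) M λ i M≤i → begin
      (1ℚ ℚ.+ ℚ.- seq δ i) ℚ.+ (g ℚ.- 1/K)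
        ≤⟨ ℚₚ.+-monoˡ-≤ (g ℚ.- 1/K) (ℚₚ.+-monoʳ-≤ 1ℚ (ℚₚ.neg-antimono-≤ (g≤δ i M≤i))) ⟩
      (1ℚ ℚ.+ ℚ.- (0ℚ ℚ.+ g)) ℚ.+ (g ℚ.- 1/K)
        ≡⟨ cong (λ p → (p ℚ.+ ℚ.- (0ℚ ℚ.+ g)) ℚ.+ (g ℚ.- 1/K)) (laziness+1⁄ k) ⟨
      ((laziness k ℚ.+ 1/K) ℚ.+ ℚ.- (0ℚ ℚ.+ g)) ℚ.+ (g ℚ.- 1/K)
        ≡⟨ cancel (laziness k) 1/K g ⟩
      laziness k  ∎
  where
  open ℚₚ.≤-Reasoning
  cancel : ∀ q p g → ((q ℚ.+ p) ℚ.+ ℚ.- (0ℚ ℚ.+ g)) ℚ.+ (g ℚ.- p) ≡ q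
  cancel = solve 3 (λ q p g → ((q :+ p) :+ :- (con 0ℚ :+ g)) :+ (g :- p) := q) refl

0≤laziness : ∀ k → 0ℝ ≤ fromℚ (laziness k)
0≤laziness k = pointwise-≤ λ _ → ⁄-mono-≤ 0 (suc k) 1 (2 ℕ.+ k) ℕ.z≤n

laziness<1 : ∀ k → fromℚ (laziness k) < 1ℝ
laziness<1 k = mk< (1 ⁄ (2 ℕ.+ k)) (0<1⁄n (2 ℕ.+ k)) 0 λ _ _ → ℚₚ.≤-reflexive (laziness+1⁄ k)

theorem1p1 : ∀ (n : ℕ) .{{_ : ℕ.NonZero n}} (G : Graph n) →
    (+ minDegree G) ℚ./ 1 ℚ.≥ (+ (2 ℕ.* n)) ℚ./ 3 ℚ.- 1ℚ →
    Ric≥ G 0ℝ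
theorem1p1 n G δ≥ {x} {y} x~y κ limit = mk≤ nonneg
  where
  open Wasserstein G (degrees-large n G δ≥)
  nonneg : ∀ ε → 0ℚ ℚ.< ε → ∃ λ M → ∀ i → M ℕ.≤ i → 0ℚ ℚ.≤ seq κ i ℚ.+ ε
  nonneg ε 0<ε =
    -- One half of `ε` is the tolerance of the limit, the other absorbs the errors in the quotient.
    let e             = ½ ℚ.* ε
        0<e           = ℚₚ.*-monoʳ-<-pos ½ 0<ε
        δ , 0<δ , near = limit (fromℚ e) (mk< e 0<e 0 λ _ _ → ℚₚ.≤-reflexive (ℚₚ.+-identityˡ e))
        k , 1-δ<α     = laziness-near-1 0<δ
        κ_α , (w , isW₁ , mk≈ κ_α≈1-w) , _ , mk< g 0<g M₁ quotient≤ =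
          near (fromℚ (laziness k)) (0≤laziness k) 1-δ<α (laziness<1 k)
        -- The real `1ℝ - α` is constantly `s`, so each term of its reciprocal is `recipℚ s`.
        s             = 1ℚ ℚ.- laziness k
        0<s           = subst (0ℚ ℚ.<_) (sym (1-laziness k)) (0<1⁄n (2 ℕ.+ k))
        0<r , sr≡1    = recipℚ-pos 0<s
        -- Errors in `κ_α` are magnified by `1/s`, hence the factor `s`.
        η             = ½ ℚ.* (e ℚ.* s)
        0<η           = ℚₚ.*-monoʳ-<-pos ½ (*-pos 0<e 0<s)
        M₂ , close    = κ_α≈1-w η 0<η
        M₃ , w≤       = _≤_.eventually-≤ (W₁≤1 x~y k isW₁) η 0<η
    in M₁ ℕ.⊔ (M₂ ℕ.⊔ M₃) , λ i M≤i →
      let M₂₃≤i = ℕₚ.m⊔n≤o⇒n≤o M₁ (M₂ ℕ.⊔ M₃) M≤i in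
      subst (λ p → 0ℚ ℚ.≤ seq κ i ℚ.+ p) (halves ε)
        (curvature-bound {seq κ_α i} {seq w i} {seq κ i} {g} {e} {s} (ℚₚ.<⇒≤ 0<r) sr≡1 (ℚₚ.<⇒≤ 0<g)
          (ℚₚ.<⇒≤ (close i (ℕₚ.m⊔n≤o⇒m≤o M₂ M₃ M₂₃≤i)))
          (w≤ i (ℕₚ.m⊔n≤o⇒n≤o M₂ M₃ M₂₃≤i))
          (quotient≤ i (ℕₚ.m⊔n≤o⇒m≤o M₁ (M₂ ℕ.⊔ M₃) M≤i)))
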